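{- Let $\ell\geq 2$ be an integer with $\ell\equiv 1 \pmod 3$ and let $p\geq 5$ be a prime. Then $\ell(3\ell+1)$ is not of the form $pm^2\pm m(p-2)$ for any positive integer $m$. Furthermore, there are infinitely many integers $n$ for which $\overline{C}_{p,1}(n)$ is an even integer.
   Context: An overpartition of a positive integer $n$ is a non-increasing sequence of positive integers summing to $n$ in which the first occurrence of each distinct part may be overlined. For integers $k\geq 3$ and $1\leq i\leq \lfloor k/2\rfloor$, $\overline{C}_{k,i}(n)$ (Andrews' singular overpartition function) denotes the number of overpartitions of $n$ in which no part is divisible by $k$ and only parts congruent to $\pm i \pmod k$ may be overlined; equivalently $\sum_{n\geq 0}\overline{C}_{k,i}(n)q^n=\frac{(q^k;q^k)_\infty(-q^i;q^k)_\infty(-q^{k-i};q^k)_\infty}{(q;q)_\infty}$, where $(a;q)_\infty=\prod_{j\geq 0}(1-aq^j)$. In particular $\overline{C}_{k,i}(0)=1$. -}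

module Defs where

open import Data.Nat using (ℕ; zero; suc; _+_; _*_; _∸_; _≤ᵇ_; _≡ᵇ_; _%_)
open import Data.Bool using (Bool; true; false; if_then_else_; _∨_)
open import Data.List using (List; upTo; map)
open import Data.Nat.ListAction using (sum)

-- Does the part size j (j ≥ 1) satisfy j ≡ ±i (mod k)?  (k ≥ 3 in all uses;
-- for k = 0 we return false, the case never arises.)
pm-i : ℕ → ℕ → ℕ → Bool
pm-i zero    i j = false
pm-i (suc k) i j = (j % suc k ≡ᵇ i % suc k) ∨ (j % suc k ≡ᵇ (suc k ∸ i) % suc k)

divides? : ℕ → ℕ → Bool
divides? zero    j = j ≡ᵇ 0
divides? (suc k) j = j % suc k ≡ᵇ 0

-- Number of ways to realise the part size j with multiplicity m in a
-- singular overpartition counted by C̄_{k,i}: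
--   * m = 0 : one way;
--   * k ∣ j and m ≥ 1 : not allowed;
--   * j ≡ ±i (mod k), m ≥ 1 : two ways (first occurrence overlined or not);
--   * otherwise, m ≥ 1 : one way.
weight : ℕ → ℕ → ℕ → ℕ → ℕ
weight k i j zero    = 1
weight k i j (suc m) =
  if divides? k j then 0 else (if pm-i k i j then 2 else 1)

-- cnt k i j n = number of overpartitions of n, all parts ≤ j, no part
-- divisible by k, and only parts ≡ ±i (mod k) may be overlined.
cnt : ℕ → ℕ → ℕ → ℕ → ℕ
cnt k i zero    zero    = 1
cnt k i zero    (suc n) = 0
cnt k i (suc j) n =
  sum (map (λ m → if m * suc j ≤ᵇ n
                    then weight k i (suc j) m * cnt k i j (n ∸ m * suc j)
                    else 0)
           (upTo (suc n)))

Cbar : ℕ → ℕ → ℕ → ℕ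
Cbar k i n = cnt k i n n

{-# OPTIONS --safe #-}

-- The equation ℓ(3ℓ+1) = pm² ± m(p-2) has no solution modulo 3.
--
-- Modulo 2 a part that may be overlined has weight 1 + 2 + 2 + ... ≡ 1, so C = Σ C̄_{p,1}(n) qⁿ is the inverse of the
-- product of 1 + q^j over j ≢ 0, ±1 (mod p). Multiplying by (q;q)_∞ and applying the Jacobi triple product modulo 2
-- with the moduli 3 and p gives
--   C(q) · Σ_m q^(m(3m+1)/2) ≡ Σ_m q^((pm² + m(p-2))/2),   m ∈ ℤ.
-- Compare the coefficients at t = ℓ(3ℓ+1)/2 with ℓ ≡ 1 (mod 3): the right side is 0 by the first part. If C̄_{p,1}(n)
-- were odd for all n in [N, t], where N ≤ ℓ, then the left side would count the 2ℓ + 1 generalized pentagonal numbers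
-- up to t (the last one meets C̄_{p,1}(0) = 1, the others leave a remainder of at least N), so it would be odd.
-- The triple product is obtained from its finite form with Gaussian binomial coefficients, truncated at a power of q.
module Submission where

open import Defs
open import Data.Nat using (ℕ; suc; _≤_; _%_)
open import Data.Nat.Divisibility using (_∣_)
open import Data.Nat.Primality using (Prime)
open import Data.Integer using (ℤ; +_) renaming (_+_ to _+ℤ_; _*_ to _*ℤ_; _-_ to _-ℤ_)
open import Data.Product using (_×_; ∃-syntax)
open import Data.Sum using (_⊎_)
open import Relation.Binary.PropositionalEquality using (_≡_; _≢_)

open import Algebra.Bundles using (CommutativeRing)
import Algebra.Construct.Pointwise as Pointwise
import Algebra.Solver.Ring as RingSolver
import Algebra.Solver.Ring.AlmostCommutativeRing as ACR
open ACR using (_-Raw-AlmostCommutative⟶_)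
import Algebra.Solver.Ring.Simple as SimpleRingSolver
open import Data.Bool using (Bool; true; false; if_then_else_; not; _∨_)
open import Data.Integer using () renaming (-_ to negℤ)
import Data.Integer.Properties as ℤₚ
open import Data.List using (map; applyUpTo)
open import Data.Maybe.Base using (just; nothing)
open import Data.Nat using (zero; _<_; z≤n; s≤s; _+_; _*_; _∸_; NonZero; >-nonZero; _≤ᵇ_; _≡ᵇ_; parity)
open import Data.Nat.DivMod using ([m+kn]%n≡m%n; m<n⇒m%n≡m; m*n%n≡0; m%n<n; m%n%n≡m%n; %-distribˡ-+; %-distribˡ-*)
open import Data.Nat.Divisibility using (divides-refl; ∣m∣n⇒∣m+n; ∣-refl; m%n≡0⇒n∣m)
open import Data.Nat.ListAction using (sum)
open import Data.Nat.Primality using (prime⇒irreducible)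
import Data.Nat.Properties as ℕₚ
open import Data.Nat.Tactic.RingSolver using (solve-∀)
open import Data.Parity.Base as ℙ using (Parity; 0ℙ; 1ℙ)
import Data.Parity.Properties as ℙₚ
open import Data.Product using (_,_)
open import Data.Sum using (inj₁; inj₂)
open import Function using (_∘_)
open import Level using (0ℓ)
open import Relation.Binary.Definitions using (WeaklyDecidable; tri<; tri≈; tri>)
open import Relation.Binary.PropositionalEquality using (refl; sym; trans; cong; cong₂; subst)
open import Relation.Nullary using (yes; no; contradiction; ofʸ; ofⁿ; _×-dec_)

-- Power series over 𝔽₂

module ℙ-Solver = SimpleRingSolver (ACR.fromCommutativeRing ℙₚ.+-*-commutativeRing) ℙₚ._≟_

Series : Set
Series = ℕ → Parity

infix 4 _≈_
_≈_ : Series → Series → Set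
f ≈ g = ∀ n → f n ≡ g n

tail : Series → Series
tail f n = f (suc n)

infixl 6 _⊕_
_⊕_ : Series → Series → Series
(f ⊕ g) n = f n ℙ.+ g n

infixl 7 _⊛_
-- The Cauchy product, read off from f = f 0 + q · `tail f`, so that it recurses on the coefficient
-- index without finite sums.
_⊛_ : Series → Series → Series
(f ⊛ g) zero    = f 0 ℙ.* g 0
(f ⊛ g) (suc n) = f 0 ℙ.* g (suc n) ℙ.+ (tail f ⊛ g) n

𝟘 𝟙 : Series
𝟘 _       = 0ℙ
𝟙 zero    = 1ℙ
𝟙 (suc _) = 0ℙ

infix 4 _≈[_]_
-- Congruence modulo q^N. Each infinite product is represented by a finite one that agrees with it
-- to such a precision.
_≈[_]_ : Series → ℕ → Series → Set
f ≈[ N ] g = ∀ n → n < N → f n ≡ g n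

⊛-cong[] : ∀ N {f f′ g g′} → f ≈[ N ] f′ → g ≈[ N ] g′ → f ⊛ g ≈[ N ] f′ ⊛ g′
⊛-cong[] N         p q zero    0<N       = cong₂ ℙ._*_ (p 0 0<N) (q 0 0<N)
⊛-cong[] (suc N)   p q (suc n) (s≤s n<N) =
  cong₂ ℙ._+_ (cong₂ ℙ._*_ (p 0 (s≤s z≤n)) (q (suc n) (s≤s n<N)))
              (⊛-cong[] N (λ m m<N → p (suc m) (s≤s m<N)) (λ m m<N → q m (ℕₚ.m<n⇒m<1+n m<N)) n n<N)

⊛-cong : ∀ {f f′ g g′} → f ≈ f′ → g ≈ g′ → f ⊛ g ≈ f′ ⊛ g′
⊛-cong p q n = ⊛-cong[] (suc n) (λ m _ → p m) (λ m _ → q m) n ℕₚ.≤-refl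

-- The definition of `⊛` splits off the constant term of the left factor; commutativity needs the
-- same for the right factor.
⊛-suc′ : ∀ f g n → (f ⊛ g) (suc n) ≡ f (suc n) ℙ.* g 0 ℙ.+ (f ⊛ tail g) n
⊛-suc′ f g zero    = ℙₚ.+-comm (f 0 ℙ.* g 1) _
⊛-suc′ f g (suc n) = trans (cong (f 0 ℙ.* g (suc (suc n)) ℙ.+_) (⊛-suc′ (tail f) g n))
  (ℙ-Solver.solve 3 (λ a b c → a :+ (b :+ c) := b :+ (a :+ c)) refl
     (f 0 ℙ.* g (suc (suc n))) (f (suc (suc n)) ℙ.* g 0) ((tail f ⊛ tail g) n))
  where open ℙ-Solver

⊛-comm : ∀ f g → f ⊛ g ≈ g ⊛ f
⊛-comm f g zero    = ℙₚ.*-comm (f 0) (g 0)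
⊛-comm f g (suc n) = trans (⊛-suc′ f g n)
  (cong₂ ℙ._+_ (ℙₚ.*-comm (f (suc n)) (g 0)) (⊛-comm f (tail g) n))

⊛-distribʳ : ∀ f g h → (g ⊕ h) ⊛ f ≈ g ⊛ f ⊕ h ⊛ f
⊛-distribʳ f g h zero    = ℙₚ.*-distribʳ-+ (f 0) (g 0) (h 0)
⊛-distribʳ f g h (suc n) = trans (cong ((g 0 ℙ.+ h 0) ℙ.* f (suc n) ℙ.+_) (⊛-distribʳ f (tail g) (tail h) n))
  (ℙ-Solver.solve 5 (λ a b c d e → (a :+ b) :* c :+ (d :+ e) := (a :* c :+ d) :+ (b :* c :+ e)) refl
     (g 0) (h 0) (f (suc n)) ((tail g ⊛ f) n) ((tail h ⊛ f) n))
  where open ℙ-Solver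

⊛-distribˡ : ∀ f g h → f ⊛ (g ⊕ h) ≈ f ⊛ g ⊕ f ⊛ h
⊛-distribˡ f g h n = trans (⊛-comm f (g ⊕ h) n)
  (trans (⊛-distribʳ f g h n) (cong₂ ℙ._+_ (⊛-comm g f n) (⊛-comm h f n)))

constant-⊛ : ∀ c f g → (λ n → c ℙ.* f n) ⊛ g ≈ (λ n → c ℙ.* (f ⊛ g) n)
constant-⊛ c f g zero    = ℙₚ.*-assoc c (f 0) (g 0)
constant-⊛ c f g (suc n) = trans (cong (c ℙ.* f 0 ℙ.* g (suc n) ℙ.+_) (constant-⊛ c (tail f) g n))
  (ℙ-Solver.solve 4 (λ c a b d → c :* a :* b :+ c :* d := c :* (a :* b :+ d)) refl
     c (f 0) (g (suc n)) ((tail f ⊛ g) n))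
  where open ℙ-Solver

⊛-assoc : ∀ f g h → (f ⊛ g) ⊛ h ≈ f ⊛ (g ⊛ h)
⊛-assoc f g h zero    = ℙₚ.*-assoc (f 0) (g 0) (h 0)
⊛-assoc f g h (suc n) = trans
  (cong ((f 0 ℙ.* g 0) ℙ.* h (suc n) ℙ.+_)
    (trans (⊛-distribʳ h (λ m → f 0 ℙ.* g (suc m)) (tail f ⊛ g) n)
      (cong₂ ℙ._+_ (constant-⊛ (f 0) (tail g) h n) (⊛-assoc (tail f) g h n))))
  (ℙ-Solver.solve 5 (λ a b c d e → (a :* b) :* c :+ (a :* d :+ e) := a :* (b :* c :+ d) :+ e) refl
     (f 0) (g 0) (h (suc n)) ((tail g ⊛ h) n) ((tail f ⊛ (g ⊛ h)) n))
  where open ℙ-Solver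

⊛-zeroˡ : ∀ f → 𝟘 ⊛ f ≈ 𝟘
⊛-zeroˡ f zero    = refl
⊛-zeroˡ f (suc n) = ⊛-zeroˡ f n

⊛-identityˡ : ∀ f → 𝟙 ⊛ f ≈ f
⊛-identityˡ f zero    = refl
⊛-identityˡ f (suc n) = trans (cong (f (suc n) ℙ.+_) (⊛-zeroˡ f n)) (ℙₚ.+-identityʳ (f (suc n)))

⊛-identityʳ : ∀ f → f ⊛ 𝟙 ≈ f
⊛-identityʳ f n = trans (⊛-comm f 𝟙 n) (⊛-identityˡ f n)

seriesRing : CommutativeRing 0ℓ 0ℓ
seriesRing = record
  -- In characteristic two every series is its own negative.
  { Carrier = Series ; _≈_ = _≈_ ; _+_ = _⊕_ ; _*_ = _⊛_ ; -_ = λ f → f ; 0# = 𝟘 ; 1# = 𝟙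
  ; isCommutativeRing = record
    { isRing = record
      { +-isAbelianGroup = Pointwise.isAbelianGroup ℕ ℙₚ.+-0-isAbelianGroup
      ; *-cong           = ⊛-cong
      ; *-assoc          = ⊛-assoc
      ; *-identity       = ⊛-identityˡ , ⊛-identityʳ
      ; distrib          = ⊛-distribˡ , ⊛-distribʳ
      }
    ; *-comm = ⊛-comm
    }
  }


constant : Parity → Series
constant 0ℙ = 𝟘
constant 1ℙ = 𝟙

constant-homomorphism : CommutativeRing.rawRing ℙₚ.+-*-commutativeRing -Raw-AlmostCommutative⟶ ACR.fromCommutativeRing seriesRing
constant-homomorphism = record
  { ⟦_⟧    = constant
  ; +-homo = λ { 0ℙ y n → refl ; 1ℙ 0ℙ n → sym (ℙₚ.+-identityʳ (𝟙 n)) ; 1ℙ 1ℙ n → sym (ℙₚ.p+p≡0ℙ (𝟙 n)) }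
  ; *-homo = λ { 0ℙ y n → sym (⊛-zeroˡ (constant y) n) ; 1ℙ y n → sym (⊛-identityˡ (constant y) n) }
  ; -‿homo = λ _ _ → refl
  ; 0-homo = λ _ → refl
  ; 1-homo = λ _ → refl
  }

constant-≟ : WeaklyDecidable (ACR.Induced-equivalence constant-homomorphism)
constant-≟ 0ℙ 0ℙ = just (λ _ → refl)
constant-≟ 1ℙ 1ℙ = just (λ _ → refl)
constant-≟ _  _  = nothing

-- Coefficients in 𝔽₂ let the solver use characteristic two.
module Series-Solver = RingSolver
  (CommutativeRing.rawRing ℙₚ.+-*-commutativeRing) (ACR.fromCommutativeRing seriesRing) constant-homomorphism constant-≟

open CommutativeRing seriesRing using (setoid) renaming (refl to ≈-refl; sym to ≈-sym; trans to ≈-trans; +-cong to ⊕-cong)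
open Series-Solver using (con; _:+_; _:*_; _:=_; solve)
open import Relation.Binary.Reasoning.Setoid setoid

-- Precision modulo powers of q, and monomials

≈⇒≈[] : ∀ N {f g} → f ≈ g → f ≈[ N ] g
≈⇒≈[] N p n _ = p n

≈[]-trans : ∀ N {f g h} → f ≈[ N ] g → g ≈[ N ] h → f ≈[ N ] h
≈[]-trans N p q n n<N = trans (p n n<N) (q n n<N)

⊕-congˡ : ∀ f {g h} → g ≈ h → f ⊕ g ≈ f ⊕ h
⊕-congˡ f p n = cong (f n ℙ.+_) (p n)

⊕-congʳ : ∀ f {g h} → g ≈ h → g ⊕ f ≈ h ⊕ f
⊕-congʳ f p n = cong (ℙ._+ f n) (p n)

⊛-congˡ : ∀ f {g h} → g ≈ h → f ⊛ g ≈ f ⊛ h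
⊛-congˡ f = ⊛-cong {f} (λ _ → refl)

⊛-congʳ : ∀ f {g h} → g ≈ h → g ⊛ f ≈ h ⊛ f
⊛-congʳ f p = ⊛-cong p (λ _ → refl)

infix 9 q^_
q^_ : ℕ → Series
q^ zero          = 𝟙
(q^ suc e) zero    = 0ℙ
(q^ suc e) (suc n) = (q^ e) n

q^-miss : ∀ e n → e ≢ n → (q^ e) n ≡ 0ℙ
q^-miss zero    zero    e≢n = contradiction refl e≢n
q^-miss zero    (suc n) e≢n = refl
q^-miss (suc e) zero    e≢n = refl
q^-miss (suc e) (suc n) e≢n = q^-miss e n (e≢n ∘ cong suc)

q^-cong : ∀ {d e} → d ≡ e → q^ d ≈ q^ e
q^-cong refl n = refl

q^-+ : ∀ d e → q^ (d + e) ≈ q^ d ⊛ q^ e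
q^-+ zero    e n       = sym (⊛-identityˡ (q^ e) n)
q^-+ (suc d) e zero    = refl
q^-+ (suc d) e (suc n) = q^-+ d e n

q^-⊛-+ : ∀ e f n → (q^ e ⊛ f) (e + n) ≡ f n
q^-⊛-+ zero    f n = ⊛-identityˡ f n
q^-⊛-+ (suc e) f n = q^-⊛-+ e f n

q^-⊛-< : ∀ e f n → n < e → (q^ e ⊛ f) n ≡ 0ℙ
q^-⊛-< (suc e) f zero    _         = refl
q^-⊛-< (suc e) f (suc n) (s≤s n<e) = q^-⊛-< e f n n<e

-- A factor q^e gains e coefficients of precision, so in the triple product a term with a large
-- exponent needs only a rough value of its Gaussian coefficient.
q^-⊛-cong[] : ∀ e N {f g} → f ≈[ N ] g → q^ e ⊛ f ≈[ e + N ] q^ e ⊛ g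
q^-⊛-cong[] zero    N {f} {g} p n n<N = trans (⊛-identityˡ f n) (trans (p n n<N) (sym (⊛-identityˡ g n)))
q^-⊛-cong[] (suc e) N p zero    _         = refl
q^-⊛-cong[] (suc e) N p (suc n) (s≤s n<N) = q^-⊛-cong[] e N p n n<N

infix 8 1+q^_
-- Modulo 2 this is 1 - q^e as well, so signs never appear.
1+q^_ : ℕ → Series
1+q^ e = 𝟙 ⊕ q^ e

1+q^-≈𝟙 : ∀ N e → N ≤ e → 1+q^ e ≈[ N ] 𝟙
1+q^-≈𝟙 N e N≤e n n<N =
  trans (cong (𝟙 n ℙ.+_) (q^-miss e n (λ { refl → ℕₚ.<-irrefl refl (ℕₚ.<-≤-trans n<N N≤e) })))
        (ℙₚ.+-identityʳ (𝟙 n))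

-- Gaussian binomial coefficients

module _ (K : ℕ) where

  -- The q-Pochhammer symbol (q^c; q^K)_n modulo 2.
  progression : ℕ → ℕ → Series
  progression c zero    = 𝟙
  progression c (suc n) = progression c n ⊛ 1+q^ (c + n * K)

  progression-split : ∀ c m n → progression c (m + n) ≈ progression c m ⊛ progression (c + m * K) n
  progression-split c m zero    = begin
    progression c (m + 0)  ≡⟨ cong (progression c) (ℕₚ.+-identityʳ m) ⟩
    progression c m        ≈⟨ ⊛-identityʳ (progression c m) ⟨
    progression c m ⊛ 𝟙    ∎
  progression-split c m (suc n) = begin
    progression c (m + suc n)
      ≡⟨ cong (progression c) (ℕₚ.+-suc m n) ⟩
    progression c (m + n) ⊛ 1+q^ (c + (m + n) * K)
      ≈⟨ ⊛-cong (progression-split c m n) (⊕-congˡ 𝟙 (q^-cong (exponent c m n K))) ⟩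
    progression c m ⊛ progression (c + m * K) n ⊛ 1+q^ (c + m * K + n * K)
      ≈⟨ ⊛-assoc (progression c m) (progression (c + m * K) n) (1+q^ (c + m * K + n * K)) ⟩
    progression c m ⊛ progression (c + m * K) (suc n) ∎
    where
    exponent : ∀ c m n K → c + (m + n) * K ≡ c + m * K + n * K
    exponent = solve-∀

  progression-first : ∀ c n → progression c (suc n) ≈ 1+q^ c ⊛ progression (K + c) n
  progression-first c n = begin
    progression c (suc n)                         ≈⟨ progression-split c 1 n ⟩
    𝟙 ⊛ 1+q^ (c + 0) ⊛ progression (c + 1 * K) n
      ≈⟨ ⊛-congʳ (progression (c + 1 * K) n) (⊛-identityˡ (1+q^ (c + 0))) ⟩
    1+q^ (c + 0) ⊛ progression (c + 1 * K) n
      ≡⟨ cong₂ (λ d e → 1+q^ d ⊛ progression e n) (ℕₚ.+-identityʳ c)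
           (trans (cong (λ x → c + x) (ℕₚ.*-identityˡ K)) (ℕₚ.+-comm c K)) ⟩
    1+q^ c ⊛ progression (K + c) n ∎

  progression-≈𝟙 : ∀ N c n → N ≤ c → progression c n ≈[ N ] 𝟙
  progression-≈𝟙 N c zero    N≤c = λ _ _ → refl
  progression-≈𝟙 N c (suc n) N≤c = ≈[]-trans N
    (⊛-cong[] N (progression-≈𝟙 N c n N≤c) (1+q^-≈𝟙 N (c + n * K) (ℕₚ.≤-trans N≤c (ℕₚ.m≤m+n c (n * K)))))
    (≈⇒≈[] N (⊛-identityˡ 𝟙))

  -- gaussian k l is the Gaussian binomial coefficient [k + l choose k] in the base q^K.
  gaussian : ℕ → ℕ → Series
  gaussian zero    l       = 𝟙
  gaussian (suc k) zero    = 𝟙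
  gaussian (suc k) (suc l) = gaussian (suc k) l ⊕ q^ (suc l * K) ⊛ gaussian k (suc l)

  gaussian-zeroʳ : ∀ k → gaussian k 0 ≈ 𝟙
  gaussian-zeroʳ zero    _ = refl
  gaussian-zeroʳ (suc k) _ = refl

  q^-swap : ∀ k l → q^ (suc (suc k) * K) ⊛ q^ (suc l * K) ≈ q^ (suc (suc l) * K) ⊛ q^ (suc k * K)
  q^-swap k l = begin
    q^ (suc (suc k) * K) ⊛ q^ (suc l * K)  ≈⟨ q^-+ (suc (suc k) * K) (suc l * K) ⟨
    q^ (suc (suc k) * K + suc l * K)       ≈⟨ q^-cong (exponent k l K) ⟩
    q^ (suc (suc l) * K + suc k * K)       ≈⟨ q^-+ (suc (suc l) * K) (suc k * K) ⟩
    q^ (suc (suc l) * K) ⊛ q^ (suc k * K)  ∎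
    where
    exponent : ∀ k l K → suc (suc k) * K + suc l * K ≡ suc (suc l) * K + suc k * K
    exponent = solve-∀

  -- The ratio (1 - q^((l + 1)K)) / (1 - q^((k + 1)K)) of neighbouring coefficients in one row, with
  -- denominators multiplied out. The induction at (k + 1, l + 1) uses both (k + 1, l) and (k, l +
  -- 1).
  gaussian-shift : ∀ k l → 1+q^ (suc k * K) ⊛ gaussian (suc k) l ≈ 1+q^ (suc l * K) ⊛ gaussian k (suc l)
  gaussian-shift zero    zero    = ≈-refl
  gaussian-shift zero    (suc l) = begin
    1+q^ (1 * K) ⊛ (gaussian 1 l ⊕ q^ (suc l * K) ⊛ 𝟙)
      ≈⟨ solve 3 (λ X Y A → (con 1ℙ :+ X) :* (A :+ Y :* con 1ℙ)
                         := (con 1ℙ :+ X) :* A :+ (con 1ℙ :+ X) :* Y) (λ _ → refl)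
           (q^ (1 * K)) (q^ (suc l * K)) (gaussian 1 l) ⟩
    1+q^ (1 * K) ⊛ gaussian 1 l ⊕ 1+q^ (1 * K) ⊛ q^ (suc l * K)
      ≈⟨ ⊕-congʳ (1+q^ (1 * K) ⊛ q^ (suc l * K)) (gaussian-shift zero l) ⟩
    1+q^ (suc l * K) ⊛ 𝟙 ⊕ 1+q^ (1 * K) ⊛ q^ (suc l * K)
      ≈⟨ solve 2 (λ X Y → (con 1ℙ :+ Y) :* con 1ℙ :+ (con 1ℙ :+ X) :* Y := con 1ℙ :+ X :* Y) (λ _ → refl)
           (q^ (1 * K)) (q^ (suc l * K)) ⟩
    𝟙 ⊕ q^ (1 * K) ⊛ q^ (suc l * K)
      ≈⟨ ⊕-congˡ 𝟙 (q^-+ (1 * K) (suc l * K)) ⟨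
    1+q^ (1 * K + suc l * K)
      ≡⟨ cong (λ K′ → 1+q^ (K′ + suc l * K)) (ℕₚ.*-identityˡ K) ⟩
    1+q^ (suc (suc l) * K)
      ≈⟨ ⊛-identityʳ (1+q^ (suc (suc l) * K)) ⟨
    1+q^ (suc (suc l) * K) ⊛ 𝟙 ∎
  gaussian-shift (suc k) zero    = begin
    1+q^ (suc (suc k) * K) ⊛ 𝟙
      ≈⟨ ⊛-identityʳ (1+q^ (suc (suc k) * K)) ⟩
    1+q^ (suc (suc k) * K)
      ≡⟨ cong (λ K′ → 1+q^ (K′ + suc k * K)) (ℕₚ.*-identityˡ K) ⟨
    1+q^ (1 * K + suc k * K)
      ≈⟨ ⊕-congˡ 𝟙 (q^-+ (1 * K) (suc k * K)) ⟩
    𝟙 ⊕ q^ (1 * K) ⊛ q^ (suc k * K)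
      ≈⟨ solve 2 (λ X Y → con 1ℙ :+ X :* Y := (con 1ℙ :+ X) :+ X :* ((con 1ℙ :+ Y) :* con 1ℙ)) (λ _ → refl)
           (q^ (1 * K)) (q^ (suc k * K)) ⟩
    1+q^ (1 * K) ⊕ q^ (1 * K) ⊛ (1+q^ (suc k * K) ⊛ 𝟙)
      ≈⟨ ⊕-congˡ (1+q^ (1 * K)) (⊛-congˡ (q^ (1 * K)) (gaussian-shift k zero)) ⟩
    1+q^ (1 * K) ⊕ q^ (1 * K) ⊛ (1+q^ (1 * K) ⊛ gaussian k 1)
      ≈⟨ solve 2 (λ X A → (con 1ℙ :+ X) :+ X :* ((con 1ℙ :+ X) :* A)
                       := (con 1ℙ :+ X) :* (con 1ℙ :+ X :* A)) (λ _ → refl)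
           (q^ (1 * K)) (gaussian k 1) ⟩
    1+q^ (1 * K) ⊛ (𝟙 ⊕ q^ (1 * K) ⊛ gaussian k 1) ∎
  gaussian-shift (suc k) (suc l) = begin
    1+q^ X ⊛ (gaussian (suc (suc k)) l ⊕ q^ Y ⊛ G)
      ≈⟨ solve 4 (λ X Y A G → (con 1ℙ :+ X) :* (A :+ Y :* G)
                           := (con 1ℙ :+ X) :* A :+ (Y :+ X :* Y) :* G) (λ _ → refl)
           (q^ X) (q^ Y) (gaussian (suc (suc k)) l) G ⟩
    1+q^ X ⊛ gaussian (suc (suc k)) l ⊕ (q^ Y ⊕ q^ X ⊛ q^ Y) ⊛ G
      ≈⟨ ⊕-congʳ ((q^ Y ⊕ q^ X ⊛ q^ Y) ⊛ G) (gaussian-shift (suc k) l) ⟩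
    1+q^ Y ⊛ G ⊕ (q^ Y ⊕ q^ X ⊛ q^ Y) ⊛ G
      ≈⟨ solve 3 (λ Y XY G → (con 1ℙ :+ Y) :* G :+ (Y :+ XY) :* G := (con 1ℙ :+ XY) :* G) (λ _ → refl)
           (q^ Y) (q^ X ⊛ q^ Y) G ⟩
    (𝟙 ⊕ q^ X ⊛ q^ Y) ⊛ G
      -- Both products are q^((k + l + 3)K); the regrouping produces the factor `1+q^ X′` of the
      -- second induction hypothesis.
      ≈⟨ ⊛-congʳ G (⊕-congˡ 𝟙 (q^-swap k l)) ⟩
    (𝟙 ⊕ q^ Y′ ⊛ q^ X′) ⊛ G
      ≈⟨ solve 3 (λ Y X G → (con 1ℙ :+ Y :* X) :* G
                         := (con 1ℙ :+ Y) :* G :+ Y :* ((con 1ℙ :+ X) :* G)) (λ _ → refl)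
           (q^ Y′) (q^ X′) G ⟩
    1+q^ Y′ ⊛ G ⊕ q^ Y′ ⊛ (1+q^ X′ ⊛ G)
      ≈⟨ ⊕-congˡ (1+q^ Y′ ⊛ G) (⊛-congˡ (q^ Y′) (gaussian-shift k (suc l))) ⟩
    1+q^ Y′ ⊛ G ⊕ q^ Y′ ⊛ (1+q^ Y′ ⊛ gaussian k (suc (suc l)))
      ≈⟨ solve 3 (λ Y A G → (con 1ℙ :+ Y) :* G :+ Y :* ((con 1ℙ :+ Y) :* A)
                         := (con 1ℙ :+ Y) :* (G :+ Y :* A)) (λ _ → refl)
           (q^ Y′) (gaussian k (suc (suc l))) G ⟩
    1+q^ Y′ ⊛ (G ⊕ q^ Y′ ⊛ gaussian k (suc (suc l))) ∎
    where
    X X′ Y Y′ : ℕ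
    X  = suc (suc k) * K
    X′ = suc k * K
    Y  = suc l * K
    Y′ = suc (suc l) * K
    G : Series
    G = gaussian (suc k) (suc l)

  -- After adding XA twice, `gaussian-shift` replaces (1 + X)A by (1 + Y)B, and the two copies of YB
  -- cancel.
  gaussian-Pascal′ : ∀ k l → gaussian (suc k) (suc l) ≈ q^ (suc k * K) ⊛ gaussian (suc k) l ⊕ gaussian k (suc l)
  gaussian-Pascal′ k l = begin
    A ⊕ Y ⊛ B
      ≈⟨ solve 4 (λ X Y A B → A :+ Y :* B := (con 1ℙ :+ X) :* A :+ (X :* A :+ Y :* B)) (λ _ → refl) X Y A B ⟩
    (𝟙 ⊕ X) ⊛ A ⊕ (X ⊛ A ⊕ Y ⊛ B)
      ≈⟨ ⊕-congʳ (X ⊛ A ⊕ Y ⊛ B) (gaussian-shift k l) ⟩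
    (𝟙 ⊕ Y) ⊛ B ⊕ (X ⊛ A ⊕ Y ⊛ B)
      ≈⟨ solve 4 (λ X Y A B → (con 1ℙ :+ Y) :* B :+ (X :* A :+ Y :* B) := X :* A :+ B) (λ _ → refl) X Y A B ⟩
    X ⊛ A ⊕ B ∎
    where
    X Y A B : Series
    X = q^ (suc k * K)
    Y = q^ (suc l * K)
    A = gaussian (suc k) l
    B = gaussian k (suc l)

  -- Exchanging k and l exchanges the two Pascal rules.
  gaussian-sym : ∀ k l → gaussian k l ≈ gaussian l k
  gaussian-sym zero    l       = ≈-sym (gaussian-zeroʳ l)
  gaussian-sym (suc k) zero    = ≈-refl
  gaussian-sym (suc k) (suc l) = begin
    gaussian (suc k) (suc l)
      ≈⟨ gaussian-Pascal′ k l ⟩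
    q^ (suc k * K) ⊛ gaussian (suc k) l ⊕ gaussian k (suc l)
      ≈⟨ ⊕-cong (⊛-congˡ (q^ (suc k * K)) (gaussian-sym (suc k) l)) (gaussian-sym k (suc l)) ⟩
    q^ (suc k * K) ⊛ gaussian l (suc k) ⊕ gaussian (suc l) k
      ≈⟨ solve 2 (λ A B → A :+ B := B :+ A) (λ _ → refl)
           (q^ (suc k * K) ⊛ gaussian l (suc k)) (gaussian (suc l) k) ⟩
    gaussian (suc l) (suc k) ∎

  -- The product formula of the Gaussian binomial coefficient, with the denominator (q^K; q^K)_l
  -- multiplied out.
  gaussian-⊛-progression : ∀ k l → gaussian k l ⊛ progression K l ≈ progression (suc k * K) l
  gaussian-⊛-progression zero    l       = begin
    𝟙 ⊛ progression K l    ≈⟨ ⊛-identityˡ (progression K l) ⟩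
    progression K l        ≡⟨ cong (λ c → progression c l) (ℕₚ.*-identityˡ K) ⟨
    progression (1 * K) l  ∎
  gaussian-⊛-progression (suc k) zero    = ⊛-identityˡ 𝟙
  gaussian-⊛-progression (suc k) (suc l) = begin
    (A ⊕ Y ⊛ B) ⊛ (P ⊛ (𝟙 ⊕ Y))
      ≈⟨ solve 4 (λ Y A B P → (A :+ Y :* B) :* (P :* (con 1ℙ :+ Y))
                           := A :* P :* (con 1ℙ :+ Y) :+ Y :* (B :* (P :* (con 1ℙ :+ Y)))) (λ _ → refl) Y A B P ⟩
    A ⊛ P ⊛ (𝟙 ⊕ Y) ⊕ Y ⊛ (B ⊛ (P ⊛ (𝟙 ⊕ Y)))
      ≈⟨ ⊕-cong (⊛-congʳ (𝟙 ⊕ Y) (gaussian-⊛-progression (suc k) l))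
                (⊛-congˡ Y (≈-trans (gaussian-⊛-progression k (suc l)) (progression-first (suc k * K) l))) ⟩
    R ⊛ (𝟙 ⊕ Y) ⊕ Y ⊛ ((𝟙 ⊕ X) ⊛ R)
      ≈⟨ solve 3 (λ X Y R → R :* (con 1ℙ :+ Y) :+ Y :* ((con 1ℙ :+ X) :* R) := R :* (con 1ℙ :+ X :* Y)) (λ _ → refl) X Y R ⟩
    R ⊛ (𝟙 ⊕ X ⊛ Y)
      ≈⟨ ⊛-congˡ R (⊕-congˡ 𝟙 (≈-trans (≈-sym (q^-+ (suc k * K) (suc l * K))) (q^-cong (exponent k l K)))) ⟩
    R ⊛ 1+q^ (suc (suc k) * K + l * K) ∎
    where
    X Y A B P R : Series
    X = q^ (suc k * K)
    Y = q^ (suc l * K)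
    A = gaussian (suc k) l
    B = gaussian k (suc l)
    P = progression K l
    R = progression (suc (suc k) * K) l
    exponent : ∀ k l K → suc k * K + suc l * K ≡ suc (suc k) * K + l * K
    exponent = solve-∀

  private
    -- The product formula absorbs the first l factors of `progression K n`; what remains are
    -- factors with exponents at least (k + 1)K and (l + 1)K, hence 1 modulo q^N.
    gaussian-limit-≤ : ∀ N k l n → N ≤ suc k * K → N ≤ suc l * K → l ≤ n →
                       gaussian k l ⊛ progression K n ≈[ N ] 𝟙
    gaussian-limit-≤ N k l n N≤k N≤l l≤n = ≈[]-trans N (≈⇒≈[] N (begin
      gaussian k l ⊛ progression K n
        ≡⟨ cong (λ n → gaussian k l ⊛ progression K n) (ℕₚ.m+[n∸m]≡n l≤n) ⟨
      gaussian k l ⊛ progression K (l + (n ∸ l))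
        ≈⟨ ⊛-congˡ (gaussian k l) (progression-split K l (n ∸ l)) ⟩
      gaussian k l ⊛ (progression K l ⊛ progression (suc l * K) (n ∸ l))
        ≈⟨ ⊛-assoc (gaussian k l) (progression K l) (progression (suc l * K) (n ∸ l)) ⟨
      gaussian k l ⊛ progression K l ⊛ progression (suc l * K) (n ∸ l)
        ≈⟨ ⊛-congʳ (progression (suc l * K) (n ∸ l)) (gaussian-⊛-progression k l) ⟩
      progression (suc k * K) l ⊛ progression (suc l * K) (n ∸ l) ∎))
      (≈[]-trans N
        (⊛-cong[] N (progression-≈𝟙 N (suc k * K) l N≤k) (progression-≈𝟙 N (suc l * K) (n ∸ l) N≤l))
        (≈⇒≈[] N (⊛-identityˡ 𝟙)))

  -- Since k + l = 2n, one of k and l is at most n, and the symmetry of the coefficient reduces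
  -- everything to l ≤ n.
  gaussian-limit : ∀ N k l n → N ≤ suc k * K → N ≤ suc l * K → k + l ≡ n + n →
                   gaussian k l ⊛ progression K n ≈[ N ] 𝟙
  gaussian-limit N k l n N≤k N≤l k+l≡2n with ℕₚ.≤-total l n
  ... | inj₁ l≤n = gaussian-limit-≤ N k l n N≤k N≤l l≤n
  ... | inj₂ n≤l = ≈[]-trans N (≈⇒≈[] N (⊛-congʳ (progression K n) (gaussian-sym k l)))
                     (gaussian-limit-≤ N l k n N≤l N≤k
                       (ℕₚ.+-cancelʳ-≤ n k n (ℕₚ.≤-trans (ℕₚ.+-monoʳ-≤ k n≤l) (ℕₚ.≤-reflexive k+l≡2n))))

-- The Jacobi triple product

-- The sum over k + l = N; carrying both indices avoids the subtraction N - k.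
antidiagonal : (ℕ → ℕ → Series) → ℕ → Series
antidiagonal F zero    = F 0 0
antidiagonal F (suc N) = F 0 (suc N) ⊕ antidiagonal (λ k → F (suc k)) N

antidiagonal-cong : ∀ {F G} N n → (∀ k l → k + l ≡ N → F k l n ≡ G k l n) → antidiagonal F N n ≡ antidiagonal G N n
antidiagonal-cong zero    n p = p 0 0 refl
antidiagonal-cong (suc N) n p =
  cong₂ ℙ._+_ (p 0 (suc N) refl) (antidiagonal-cong N n (λ k l k+l≡N → p (suc k) l (cong suc k+l≡N)))

⊛-antidiagonal : ∀ f F N → f ⊛ antidiagonal F N ≈ antidiagonal (λ k l → f ⊛ F k l) N
⊛-antidiagonal f F zero    = ≈-refl
⊛-antidiagonal f F (suc N) = ≈-trans (⊛-distribˡ f (F 0 (suc N)) (antidiagonal (λ k → F (suc k)) N))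
  (⊕-congˡ (f ⊛ F 0 (suc N)) (⊛-antidiagonal f (λ k → F (suc k)) N))

antidiagonal-last : ∀ F N → antidiagonal F (suc N) ≈ antidiagonal (λ k l → F k (suc l)) N ⊕ F (suc N) 0
antidiagonal-last F zero    = ≈-refl
antidiagonal-last F (suc N) = ≈-trans
  (⊕-congˡ (F 0 (suc (suc N))) (antidiagonal-last (λ k → F (suc k)) N))
  (solve 3 (λ a b c → a :+ (b :+ c) := a :+ b :+ c) (λ _ → refl)
    (F 0 (suc (suc N))) (antidiagonal (λ k l → F (suc k) (suc l)) N) (F (suc (suc N)) 0))

shiftʳ : (ℕ → ℕ → Series) → ℕ → ℕ → Series
shiftʳ F zero    l = 𝟘
shiftʳ F (suc k) l = F k l

-- A Pascal rule turns a sum over k + l = N + 1 into two sums over k + l = N. At k = 0 only A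
-- contributes, at l = 0 only B.
antidiagonal-Pascal : ∀ F A B N →
  (∀ k l → F k (suc l) ≈ A k l ⊕ shiftʳ B k (suc l)) → (∀ k → F (suc k) 0 ≈ B k 0) →
  antidiagonal F (suc N) ≈ antidiagonal A N ⊕ antidiagonal B N
antidiagonal-Pascal F A B N p p₀ = split F A (shiftʳ B) N p p₀
  where
  -- Stated for any B in place of `shiftʳ B`, so that the induction may drop the first term. The sum
  -- of `shiftʳ B` itself begins with 𝟘, which leaves the sum of B over k + l = N.
  split : ∀ F A B N → (∀ k l → F k (suc l) ≈ A k l ⊕ B k (suc l)) → (∀ k → F (suc k) 0 ≈ B (suc k) 0) →
          antidiagonal F (suc N) ≈ antidiagonal A N ⊕ antidiagonal B (suc N)
  split F A B zero    p p₀ = ≈-trans (⊕-cong (p 0 0) (p₀ 0))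
    (solve 3 (λ a b c → a :+ b :+ c := a :+ (b :+ c)) (λ _ → refl) (A 0 0) (B 0 1) (B 1 0))
  split F A B (suc N) p p₀ = ≈-trans
    (⊕-cong (p 0 (suc N)) (split (λ k → F (suc k)) (λ k → A (suc k)) (λ k → B (suc k)) N (p ∘ suc) (p₀ ∘ suc)))
    (solve 4 (λ a b c d → a :+ b :+ (c :+ d) := a :+ c :+ (b :+ d)) (λ _ → refl)
      (A 0 (suc N)) (B 0 (suc (suc N))) (antidiagonal (λ k → A (suc k)) N) (antidiagonal (λ k → B (suc k)) (suc N)))

-- exponent K c r = c r + K r (r - 1) / 2
exponent : ℕ → ℕ → ℕ → ℕ
exponent K c zero    = 0
exponent K c (suc r) = exponent K c r + (c + r * K)

r≤exponent : ∀ K c r → 1 ≤ c → r ≤ exponent K c r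
r≤exponent K c zero    1≤c = z≤n
r≤exponent K c (suc r) 1≤c = subst (_≤ exponent K c (suc r)) (ℕₚ.+-comm r 1)
  (ℕₚ.+-mono-≤ (r≤exponent K c r 1≤c) (ℕₚ.≤-trans 1≤c (ℕₚ.m≤m+n c (r * K))))

module TripleProduct (a b : ℕ) (1≤a : 1 ≤ a) (1≤b : 1 ≤ b) where

  private
    K : ℕ
    K = a + b

  -- The index k stands for the integer k - n, at which the exponent is that of the theta series.
  exponentℤ : ℕ → ℕ → ℕ
  exponentℤ k       zero    = exponent K a k
  exponentℤ zero    (suc n) = exponent K b (suc n)
  exponentℤ (suc k) (suc n) = exponentℤ k n

  exponentℤ-zero : ∀ n → exponentℤ 0 n ≡ exponent K b n
  exponentℤ-zero zero    = refl
  exponentℤ-zero (suc n) = refl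

  -- With i = k - n the exponent grows by a + iK from i to i + 1, and k + l = m + n makes m - l
  -- equal to i.
  exponentℤ-stepˡ : ∀ k l m n → k + l ≡ m + n → a + m * K + exponentℤ k n ≡ l * K + exponentℤ (suc k) n
  exponentℤ-stepˡ k l m zero k+l≡m rewrite trans (sym (ℕₚ.+-identityʳ m)) (sym k+l≡m) =
    lemma a K k l (exponent K a k)
    where
    lemma : ∀ a K k l e → a + (k + l) * K + e ≡ l * K + (e + (a + k * K))
    lemma = solve-∀
  exponentℤ-stepˡ zero l m (suc n) refl rewrite exponentℤ-zero n = lemma a b m n (exponent K b n)
    where
    lemma : ∀ a b m n e → a + m * (a + b) + (e + (b + n * (a + b))) ≡ (m + suc n) * (a + b) + e
    lemma = solve-∀
  exponentℤ-stepˡ (suc k) l m (suc n) k+l≡m+n =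
    exponentℤ-stepˡ k l m n (ℕₚ.suc-injective (trans k+l≡m+n (ℕₚ.+-suc m n)))

  -- Lowering i = k - n by one adds b - iK to the exponent.
  exponentℤ-stepʳ : ∀ k n → b + n * K + exponentℤ k n ≡ k * K + exponentℤ k (suc n)
  exponentℤ-stepʳ zero    n rewrite exponentℤ-zero n = ℕₚ.+-comm (b + n * K) (exponent K b n)
  exponentℤ-stepʳ (suc k) zero    = lemma a b k (exponent K a k)
    where
    lemma : ∀ a b k e → b + 0 + (e + (a + k * (a + b))) ≡ a + b + k * (a + b) + e
    lemma = solve-∀
  exponentℤ-stepʳ (suc k) (suc n) = lemma b K n k (exponentℤ k n) (exponentℤ k (suc n)) (exponentℤ-stepʳ k n)
    where
    lemma : ∀ b K n k e e′ → b + n * K + e ≡ k * K + e′ → b + (K + n * K) + e ≡ K + k * K + e′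
    lemma b K n k e e′ p = trans (assoc b K (n * K) e) (trans (cong (λ x → K + x) p) (sym (ℕₚ.+-assoc K (k * K) e′)))
      where
      assoc : ∀ b K nK e → b + (K + nK) + e ≡ K + (b + nK + e)
      assoc = solve-∀

  -- Together with `k≤exponentℤ+n` this bounds |k - n| by the exponent, which controls the precision
  -- in `triple-product`.
  n≤exponentℤ+k : ∀ k n → n ≤ exponentℤ k n + k
  n≤exponentℤ+k k       zero    = z≤n
  n≤exponentℤ+k zero    (suc n) = ℕₚ.≤-trans (r≤exponent K b (suc n) 1≤b) (ℕₚ.m≤m+n _ 0)
  n≤exponentℤ+k (suc k) (suc n) =
    ℕₚ.≤-trans (s≤s (n≤exponentℤ+k k n)) (ℕₚ.≤-reflexive (sym (ℕₚ.+-suc (exponentℤ k n) k)))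

  k≤exponentℤ+n : ∀ k n → k ≤ exponentℤ k n + n
  k≤exponentℤ+n k       zero    = ℕₚ.≤-trans (r≤exponent K a k 1≤a) (ℕₚ.m≤m+n _ 0)
  k≤exponentℤ+n zero    (suc n) = z≤n
  k≤exponentℤ+n (suc k) (suc n) =
    ℕₚ.≤-trans (s≤s (k≤exponentℤ+n k n)) (ℕₚ.≤-reflexive (sym (ℕₚ.+-suc (exponentℤ k n) n)))

  term : ℕ → ℕ → ℕ → Series
  term n k l = gaussian K k l ⊛ q^ (exponentℤ k n)

  1+q^-⊛-antidiagonal : ∀ e F N → 1+q^ e ⊛ antidiagonal F N ≈ antidiagonal F N ⊕ antidiagonal (λ k l → q^ e ⊛ F k l) N
  1+q^-⊛-antidiagonal e F N = begin
    1+q^ e ⊛ antidiagonal F N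
      ≈⟨ solve 2 (λ x s → (con 1ℙ :+ x) :* s := s :+ x :* s) (λ _ → refl) (q^ e) (antidiagonal F N) ⟩
    antidiagonal F N ⊕ q^ e ⊛ antidiagonal F N
      ≈⟨ ⊕-congˡ (antidiagonal F N) (⊛-antidiagonal (q^ e) F N) ⟩
    antidiagonal F N ⊕ antidiagonal (λ k l → q^ e ⊛ F k l) N ∎

  -- One factor is added at a time, first those of `progression K b`, then those of
  -- `progression K a`. Multiplying by `1+q^ e` gives the old sum and a shifted copy, which a Pascal
  -- rule joins: `gaussian-Pascal′` for b, where the centre n moves, and the defining rule for a.
  finite-triple-product : ∀ m n → progression K a m ⊛ progression K b n ≈ antidiagonal (term n) (m + n)
  finite-triple-product zero zero = ≈-refl
  finite-triple-product zero (suc n) = begin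
    𝟙 ⊛ (progression K b n ⊛ 1+q^ e)
      ≈⟨ solve 2 (λ p x → con 1ℙ :* (p :* x) := x :* (con 1ℙ :* p)) (λ _ → refl) (progression K b n) (1+q^ e) ⟩
    1+q^ e ⊛ (𝟙 ⊛ progression K b n)
      ≈⟨ ⊛-congˡ (1+q^ e) (finite-triple-product zero n) ⟩
    1+q^ e ⊛ antidiagonal (term n) n
      ≈⟨ 1+q^-⊛-antidiagonal e (term n) n ⟩
    antidiagonal (term n) n ⊕ antidiagonal (λ k l → q^ e ⊛ term n k l) n
      ≈⟨ ⊕-congˡ (antidiagonal (term n) n) (λ i → antidiagonal-cong n i (λ k l _ → shift k l i)) ⟩
    antidiagonal (term n) n ⊕ antidiagonal A n
      ≈⟨ solve 2 (λ x y → x :+ y := y :+ x) (λ _ → refl) (antidiagonal (term n) n) (antidiagonal A n) ⟩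
    antidiagonal A n ⊕ antidiagonal (term n) n
      ≈⟨ antidiagonal-Pascal (term (suc n)) A (term n) n Pascal
           (λ k → ⊛-congʳ (q^ exponentℤ k n) (≈-sym (gaussian-zeroʳ K k))) ⟨
    antidiagonal (term (suc n)) (suc n) ∎
    where
    e : ℕ
    e = b + n * K
    A : ℕ → ℕ → Series
    A k l = q^ (k * K) ⊛ term (suc n) k l
    shift : ∀ k l → q^ e ⊛ term n k l ≈ A k l
    shift k l = begin
      q^ e ⊛ (gaussian K k l ⊛ q^ exponentℤ k n)
        ≈⟨ solve 3 (λ x g y → x :* (g :* y) := g :* (x :* y)) (λ _ → refl) (q^ e) (gaussian K k l) (q^ exponentℤ k n) ⟩
      gaussian K k l ⊛ (q^ e ⊛ q^ exponentℤ k n)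
        ≈⟨ ⊛-congˡ (gaussian K k l) (≈-trans (≈-sym (q^-+ e (exponentℤ k n)))
             (≈-trans (q^-cong (exponentℤ-stepʳ k n)) (q^-+ (k * K) (exponentℤ k (suc n))))) ⟩
      gaussian K k l ⊛ (q^ (k * K) ⊛ q^ exponentℤ k (suc n))
        ≈⟨ solve 3 (λ x g y → g :* (x :* y) := x :* (g :* y)) (λ _ → refl)
             (q^ (k * K)) (gaussian K k l) (q^ exponentℤ k (suc n)) ⟩
      A k l ∎
    Pascal : ∀ k l → term (suc n) k (suc l) ≈ A k l ⊕ shiftʳ (term n) k (suc l)
    Pascal zero    l = solve 1 (λ x → con 1ℙ :* x := con 1ℙ :* (con 1ℙ :* x) :+ con 0ℙ) (λ _ → refl)
                         (q^ exponentℤ 0 (suc n))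
    Pascal (suc k) l = begin
      gaussian K (suc k) (suc l) ⊛ y
        ≈⟨ ⊛-congʳ y (gaussian-Pascal′ K k l) ⟩
      (q^ (suc k * K) ⊛ gaussian K (suc k) l ⊕ gaussian K k (suc l)) ⊛ y
        ≈⟨ solve 4 (λ x g h y → (x :* g :+ h) :* y := x :* (g :* y) :+ h :* y) (λ _ → refl)
             (q^ (suc k * K)) (gaussian K (suc k) l) (gaussian K k (suc l)) y ⟩
      A (suc k) l ⊕ term n k (suc l) ∎
      where
      y : Series
      -- `exponentℤ (suc k) (suc n)` reduces to this exponent, so one power serves `term (suc n)` at
      -- k + 1 and `term n` at k.
      y = q^ exponentℤ k n
  finite-triple-product (suc m) n = begin
    progression K a m ⊛ 1+q^ e ⊛ progression K b n
      ≈⟨ solve 3 (λ p x r → p :* x :* r := x :* (p :* r)) (λ _ → refl) (progression K a m) (1+q^ e) (progression K b n) ⟩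
    1+q^ e ⊛ (progression K a m ⊛ progression K b n)
      ≈⟨ ⊛-congˡ (1+q^ e) (finite-triple-product m n) ⟩
    1+q^ e ⊛ antidiagonal (term n) (m + n)
      ≈⟨ 1+q^-⊛-antidiagonal e (term n) (m + n) ⟩
    antidiagonal (term n) (m + n) ⊕ antidiagonal (λ k l → q^ e ⊛ term n k l) (m + n)
      ≈⟨ ⊕-congˡ (antidiagonal (term n) (m + n))
           (λ i → antidiagonal-cong (m + n) i (λ k l k+l≡m+n → shift k l k+l≡m+n i)) ⟩
    antidiagonal (term n) (m + n) ⊕ antidiagonal B (m + n)
      ≈⟨ antidiagonal-Pascal (term n) (term n) B (m + n) Pascal Pascal-zero ⟨
    antidiagonal (term n) (suc (m + n)) ∎
    where
    e : ℕ
    e = a + m * K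
    B : ℕ → ℕ → Series
    B k l = q^ (l * K) ⊛ gaussian K k l ⊛ q^ (exponentℤ (suc k) n)
    shift : ∀ k l → k + l ≡ m + n → q^ e ⊛ term n k l ≈ B k l
    shift k l k+l≡m+n = begin
      q^ e ⊛ (gaussian K k l ⊛ q^ exponentℤ k n)
        ≈⟨ solve 3 (λ x g y → x :* (g :* y) := g :* (x :* y)) (λ _ → refl) (q^ e) (gaussian K k l) (q^ exponentℤ k n) ⟩
      gaussian K k l ⊛ (q^ e ⊛ q^ exponentℤ k n)
        ≈⟨ ⊛-congˡ (gaussian K k l) (≈-trans (≈-sym (q^-+ e (exponentℤ k n)))
             (≈-trans (q^-cong (exponentℤ-stepˡ k l m n k+l≡m+n)) (q^-+ (l * K) (exponentℤ (suc k) n)))) ⟩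
      gaussian K k l ⊛ (q^ (l * K) ⊛ q^ exponentℤ (suc k) n)
        ≈⟨ solve 3 (λ x g y → g :* (x :* y) := x :* g :* y) (λ _ → refl)
             (q^ (l * K)) (gaussian K k l) (q^ exponentℤ (suc k) n) ⟩
      B k l ∎
    Pascal : ∀ k l → term n k (suc l) ≈ term n k l ⊕ shiftʳ B k (suc l)
    Pascal zero    l = solve 1 (λ x → con 1ℙ :* x := con 1ℙ :* x :+ con 0ℙ) (λ _ → refl) (q^ exponentℤ 0 n)
    Pascal (suc k) l = ⊛-distribʳ (q^ exponentℤ (suc k) n) (gaussian K (suc k) l)
                         (q^ (suc l * K) ⊛ gaussian K k (suc l))
    Pascal-zero : ∀ k → term n (suc k) 0 ≈ B k 0
    Pascal-zero k = ⊛-congʳ (q^ exponentℤ (suc k) n)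
      (≈-trans (≈-sym (gaussian-zeroʳ K k)) (≈-sym (⊛-identityˡ (gaussian K k 0))))

  -- The part with -n ≤ i ≤ n of the series Σ q^(ai + K i(i - 1)/2) over all integers i.
  theta : ℕ → Series
  theta zero    = 𝟙
  theta (suc n) = theta n ⊕ (q^ exponent K a (suc n) ⊕ q^ exponent K b (suc n))

  -- `exponentℤ` depends only on k - n, so passing from n to n + 1 keeps the inner terms and adds
  -- one at each end.
  antidiagonal-theta : ∀ n → antidiagonal (λ k _ → q^ exponentℤ k n) (n + n) ≈ theta n
  antidiagonal-theta zero    = ≈-refl
  antidiagonal-theta (suc n) = begin
    minus ⊕ antidiagonal (λ k _ → q^ exponentℤ k n) (n + suc n)
      ≡⟨ cong (λ N → minus ⊕ antidiagonal (λ k _ → q^ exponentℤ k n) N) (ℕₚ.+-suc n n) ⟩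
    minus ⊕ antidiagonal (λ k _ → q^ exponentℤ k n) (suc (n + n))
      ≈⟨ ⊕-congˡ minus (antidiagonal-last (λ k _ → q^ exponentℤ k n) (n + n)) ⟩
    minus ⊕ (antidiagonal (λ k _ → q^ exponentℤ k n) (n + n) ⊕ q^ exponentℤ (suc (n + n)) n)
      ≈⟨ ⊕-congˡ minus (⊕-cong (antidiagonal-theta n) (q^-cong (exponentℤ-+ (suc n) n))) ⟩
    minus ⊕ (theta n ⊕ plus)
      ≈⟨ solve 3 (λ x y z → x :+ (y :+ z) := y :+ (z :+ x)) (λ _ → refl) minus (theta n) plus ⟩
    theta (suc n) ∎
    where
    plus minus : Series
    plus  = q^ exponent K a (suc n)
    minus = q^ exponent K b (suc n)
    exponentℤ-+ : ∀ r n → exponentℤ (r + n) n ≡ exponent K a r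
    exponentℤ-+ r zero    = cong (exponent K a) (ℕₚ.+-identityʳ r)
    exponentℤ-+ r (suc n) rewrite ℕₚ.+-suc r n = exponentℤ-+ r n

  -- In the finite identity with m = n, multiplication by (q^K; q^K)_n turns each Gaussian
  -- coefficient into 1, to the precision that its monomial leaves open.
  triple-product : ∀ n → progression K K n ⊛ (progression K a n ⊛ progression K b n) ≈[ suc n ] theta n
  triple-product n = ≈[]-trans (suc n)
    (≈⇒≈[] (suc n) (≈-trans (⊛-congˡ (progression K K n) (finite-triple-product n n))
                            (⊛-antidiagonal (progression K K n) (term n) (n + n))))
    (≈[]-trans (suc n) (λ i i<1+n → antidiagonal-cong (n + n) i (λ k l k+l≡2n → limit k l k+l≡2n i i<1+n))
      (≈⇒≈[] (suc n) (antidiagonal-theta n)))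
    where
    instance
      K-nonZero : NonZero K
      K-nonZero = >-nonZero (ℕₚ.≤-trans 1≤a (ℕₚ.m≤m+n a b))
    limit : ∀ k l → k + l ≡ n + n → progression K K n ⊛ term n k l ≈[ suc n ] q^ exponentℤ k n
    limit k l k+l≡2n = ≈[]-trans (suc n)
      (≈⇒≈[] (suc n) (solve 3 (λ p g x → p :* (g :* x) := x :* (g :* p)) (λ _ → refl)
        (progression K K n) (gaussian K k l) (q^ e)))
      (≈[]-trans (suc n)
        (λ i i<1+n → q^-⊛-cong[] e N (gaussian-limit K N k l n N≤k N≤l k+l≡2n) i
          (ℕₚ.<-≤-trans i<1+n (ℕₚ.m≤n+m∸n (suc n) e)))
        (≈⇒≈[] (suc n) (⊛-identityʳ (q^ e))))
      where
      e N : ℕ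
      e = exponentℤ k n
      -- The monomial q^e already accounts for e of the n + 1 coefficients.
      N = suc n ∸ e
      N≤suc : ∀ j → n ≤ e + j → N ≤ suc j * K
      N≤suc j n≤e+j = ℕₚ.≤-trans
        (ℕₚ.m≤n+o⇒m∸n≤o (suc n) e (ℕₚ.≤-trans (s≤s n≤e+j) (ℕₚ.≤-reflexive (sym (ℕₚ.+-suc e j)))))
        (ℕₚ.m≤m*n (suc j) K)
      N≤k : N ≤ suc k * K
      N≤k = N≤suc k (n≤exponentℤ+k k n)
      N≤l : N ≤ suc l * K
      N≤l = N≤suc l (ℕₚ.+-cancelʳ-≤ n n (e + l) (ℕₚ.≤-trans (ℕₚ.≤-reflexive (sym k+l≡2n))
        (ℕₚ.≤-trans (ℕₚ.+-monoˡ-≤ l (k≤exponentℤ+n k n)) (ℕₚ.≤-reflexive (swap e n l)))))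
        where
        swap : ∀ e n l → e + n + l ≡ e + l + n
        swap = solve-∀

-- Singular overpartitions modulo 2

sumBelow : (ℕ → Series) → ℕ → Series
sumBelow F zero    = 𝟘
sumBelow F (suc N) = F 0 ⊕ sumBelow (F ∘ suc) N

sumBelow-zero : ∀ F N n → (∀ m → F m n ≡ 0ℙ) → sumBelow F N n ≡ 0ℙ
sumBelow-zero F zero    n p = refl
sumBelow-zero F (suc N) n p = cong₂ ℙ._+_ (p 0) (sumBelow-zero (F ∘ suc) N n (p ∘ suc))

sumBelow-extend : ∀ F {M N} n → M ≤ N → (∀ m → M ≤ m → F m n ≡ 0ℙ) → sumBelow F M n ≡ sumBelow F N n
sumBelow-extend F {N = N} n z≤n       p = sym (sumBelow-zero F N n (λ m → p m z≤n))
sumBelow-extend F         n (s≤s M≤N) p =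
  cong (F 0 n ℙ.+_) (sumBelow-extend (F ∘ suc) n M≤N (λ m M≤m → p (suc m) (s≤s M≤m)))

-- Consecutive values of H cancel in characteristic two.
sumBelow-telescope : ∀ f F H N → (∀ m → f ⊛ F m ≈ H m ⊕ H (suc m)) → f ⊛ sumBelow F N ≈ H 0 ⊕ H N
sumBelow-telescope f F H zero    p = solve 2 (λ f h → f :* con 0ℙ := h :+ h) (λ _ → refl) f (H 0)
sumBelow-telescope f F H (suc N) p = begin
  f ⊛ (F 0 ⊕ sumBelow (F ∘ suc) N)
    ≈⟨ ⊛-distribˡ f (F 0) (sumBelow (F ∘ suc) N) ⟩
  f ⊛ F 0 ⊕ f ⊛ sumBelow (F ∘ suc) N
    ≈⟨ ⊕-cong (p 0) (sumBelow-telescope f (F ∘ suc) (H ∘ suc) N (p ∘ suc)) ⟩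
  H 0 ⊕ H 1 ⊕ (H 1 ⊕ H (suc N))
    ≈⟨ solve 3 (λ a b c → a :+ b :+ (b :+ c) := a :+ c) (λ _ → refl) (H 0) (H 1) (H (suc N)) ⟩
  H 0 ⊕ H (suc N) ∎

-- `upTo` is `applyUpTo` of the identity; f is general because each step of the induction replaces
-- it by `f ∘ suc`.
parity-sum : ∀ h F n N (f : ℕ → ℕ) → (∀ m → parity (h (f m)) ≡ F m n) →
             parity (sum (map h (applyUpTo f N))) ≡ sumBelow F N n
parity-sum h F n zero    f p = refl
parity-sum h F n (suc N) f p = trans (ℙₚ.+-homo-+ (h (f 0)) (sum (map h (applyUpTo (f ∘ suc) N))))
  (cong₂ ℙ._+_ (p 0) (parity-sum h (F ∘ suc) n N (f ∘ suc) (p ∘ suc)))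

-- The guard in `cnt` drops exactly the negative arguments, where the product with q^e has
-- coefficient 0.
parity-shift : ∀ (g : ℕ → ℕ) e n w →
  parity (if e ≤ᵇ n then w * g (n ∸ e) else 0) ≡ parity w ℙ.* (q^ e ⊛ (parity ∘ g)) n
parity-shift g e n w with e ≤ᵇ n | ℕₚ.≤ᵇ-reflects-≤ e n
... | true  | ofʸ e≤n = trans (ℙₚ.*-homo-* w (g (n ∸ e)))
  (cong (parity w ℙ.*_) (sym (trans (cong (q^ e ⊛ (parity ∘ g)) (sym (ℕₚ.m+[n∸m]≡n e≤n)))
                                    (q^-⊛-+ e (parity ∘ g) (n ∸ e)))))
... | false | ofⁿ e≰n = sym (trans (cong (parity w ℙ.*_) (q^-⊛-< e (parity ∘ g) n (ℕₚ.≰⇒> e≰n)))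
                                   (ℙₚ.*-zeroʳ (parity w)))

restrictedProduct : (ℕ → Bool) → ℕ → Series
restrictedProduct S zero    = 𝟙
restrictedProduct S (suc J) = restrictedProduct S J ⊛ (if S (suc J) then 1+q^ suc J else 𝟙)

restrictedProduct-cong : ∀ {S S′} J → (∀ j → S j ≡ S′ j) → restrictedProduct S J ≈ restrictedProduct S′ J
restrictedProduct-cong zero    p = ≈-refl
restrictedProduct-cong {S} {S′} (suc J) p rewrite p (suc J) =
  ⊛-congʳ (if S′ (suc J) then 1+q^ suc J else 𝟙) (restrictedProduct-cong J p)

restrictedProduct-complement : ∀ S J →
  restrictedProduct S J ⊛ restrictedProduct (not ∘ S) J ≈ restrictedProduct (λ _ → true) J
restrictedProduct-complement S zero    = ⊛-identityˡ 𝟙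
restrictedProduct-complement S (suc J) = ≈-trans (factor (S (suc J)))
  (⊛-congʳ (1+q^ suc J) (restrictedProduct-complement S J))
  where
  P P′ : Series
  P  = restrictedProduct S J
  P′ = restrictedProduct (not ∘ S) J
  factor : ∀ s → (P ⊛ (if s then 1+q^ suc J else 𝟙)) ⊛ (P′ ⊛ (if not s then 1+q^ suc J else 𝟙)) ≈ P ⊛ P′ ⊛ 1+q^ suc J
  factor true  = solve 3 (λ p p′ x → p :* x :* (p′ :* con 1ℙ) := p :* p′ :* x) (λ _ → refl) P P′ (1+q^ suc J)
  factor false = solve 3 (λ p p′ x → p :* con 1ℙ :* (p′ :* x) := p :* p′ :* x) (λ _ → refl) P P′ (1+q^ suc J)

module _ (k i : ℕ) where

  -- Modulo 2 a part size in this set contributes nothing: it is either forbidden, or comes with the even weight 2.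
  vanishing : ℕ → Bool
  vanishing j = divides? k j ∨ pm-i k i j

  parity-weight : ∀ j m → parity (weight k i j (suc m)) ≡ (if vanishing j then 0ℙ else 1ℙ)
  parity-weight j m with divides? k j | pm-i k i j
  ... | true  | _     = refl
  ... | false | true  = refl
  ... | false | false = refl

  cntSeries : ℕ → Series
  cntSeries J = parity ∘ cnt k i J

  -- If J + 1 is vanishing, only multiplicity 0 survives modulo 2. Otherwise all multiplicities have
  -- weight 1 and form a geometric series, the inverse of `1+q^ suc J`.
  cntSeries-step : ∀ J → (if not (vanishing (suc J)) then 1+q^ suc J else 𝟙) ⊛ cntSeries (suc J) ≈ cntSeries J
  cntSeries-step J with vanishing (suc J) in eq
  ... | true  = λ n → trans (⊛-identityˡ (cntSeries (suc J)) n)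
    (trans (parity-sum (h n) F n (suc n) (λ m → m) (p n))
      (trans (cong (cntSeries J n ℙ.+_) (sumBelow-zero (F ∘ suc) n n (λ _ → refl)))
             (ℙₚ.+-identityʳ (cntSeries J n))))
    where
    h : ℕ → ℕ → ℕ
    h n m = if m * suc J ≤ᵇ n then weight k i (suc J) m * cnt k i J (n ∸ m * suc J) else 0
    F : ℕ → Series
    F zero    = cntSeries J
    F (suc m) = 𝟘
    p : ∀ n m → parity (h n m) ≡ F m n
    p n zero    = trans (parity-shift (cnt k i J) 0 n 1) (⊛-identityˡ (cntSeries J) n)
    p n (suc m) = trans (parity-shift (cnt k i J) (suc m * suc J) n (weight k i (suc J) (suc m)))
      (cong (ℙ._* (q^ (suc m * suc J) ⊛ cntSeries J) n)
        (trans (parity-weight (suc J) m) (cong (λ v → if v then 0ℙ else 1ℙ) eq)))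
  ... | false = λ n → trans
    (⊛-cong[] (suc n) {f = 1+q^ suc J} (λ _ _ → refl) (truncation n) n ℕₚ.≤-refl)
    (trans (sumBelow-telescope (1+q^ suc J) F F (suc n) telescope n)
      (trans (cong₂ ℙ._+_ (⊛-identityˡ (cntSeries J) n)
                          -- The last term of the telescoping sum has exponent (n + 1)(J + 1) > n,
                          -- so it does not reach the coefficient n.
                          (q^-⊛-< (suc n * suc J) (cntSeries J) n (ℕₚ.m≤m*n (suc n) (suc J))))
             (ℙₚ.+-identityʳ (cntSeries J n))))
    where
    h : ℕ → ℕ → ℕ
    h n m = if m * suc J ≤ᵇ n then weight k i (suc J) m * cnt k i J (n ∸ m * suc J) else 0
    F : ℕ → Series
    F m = q^ (m * suc J) ⊛ cntSeries J
    p : ∀ n m → parity (h n m) ≡ F m n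
    p n zero    = parity-shift (cnt k i J) 0 n 1
    p n (suc m) = trans (parity-shift (cnt k i J) (suc m * suc J) n (weight k i (suc J) (suc m)))
      (cong (ℙ._* F (suc m) n) (trans (parity-weight (suc J) m) (cong (λ v → if v then 0ℙ else 1ℙ) eq)))
    -- At the coefficient j, `cnt` sums over m ≤ j; extending the range to m ≤ n adds only terms
    -- with exponent above j.
    truncation : ∀ n → cntSeries (suc J) ≈[ suc n ] sumBelow F (suc n)
    truncation n j j<1+n = trans (parity-sum (h j) F j (suc j) (λ m → m) (p j))
      (sumBelow-extend F j j<1+n (λ m j<m →
        q^-⊛-< (m * suc J) (cntSeries J) j (ℕₚ.<-≤-trans j<m (ℕₚ.m≤m*n m (suc J)))))
    telescope : ∀ m → 1+q^ suc J ⊛ F m ≈ F m ⊕ F (suc m)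
    telescope m = begin
      1+q^ suc J ⊛ (q^ (m * suc J) ⊛ cntSeries J)
        ≈⟨ solve 3 (λ x y c → (con 1ℙ :+ x) :* (y :* c) := y :* c :+ x :* y :* c) (λ _ → refl)
             (q^ suc J) (q^ (m * suc J)) (cntSeries J) ⟩
      F m ⊕ q^ suc J ⊛ q^ (m * suc J) ⊛ cntSeries J
        ≈⟨ ⊕-congˡ (F m) (⊛-congʳ (cntSeries J) (q^-+ (suc J) (m * suc J))) ⟨
      F m ⊕ F (suc m) ∎

  restrictedProduct-⊛-cntSeries : ∀ J → restrictedProduct (not ∘ vanishing) J ⊛ cntSeries J ≈ 𝟙
  restrictedProduct-⊛-cntSeries zero    = ≈-trans (⊛-identityˡ (cntSeries 0)) (λ { zero → refl ; (suc n) → refl })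
  restrictedProduct-⊛-cntSeries (suc J) = ≈-trans
    (⊛-assoc (restrictedProduct (not ∘ vanishing) J) (if not (vanishing (suc J)) then 1+q^ suc J else 𝟙) (cntSeries (suc J)))
    (≈-trans (⊛-congˡ (restrictedProduct (not ∘ vanishing) J) (cntSeries-step J)) (restrictedProduct-⊛-cntSeries J))

  cntSeries-stable : ∀ J → cntSeries (suc J) ≈[ suc J ] cntSeries J
  cntSeries-stable J = ≈[]-trans (suc J) (λ n n<J → sym (absorb n n<J)) (≈⇒≈[] (suc J) (cntSeries-step J))
    where
    factor : ∀ v → (if v then 1+q^ suc J else 𝟙) ≈[ suc J ] 𝟙
    factor true  = 1+q^-≈𝟙 (suc J) (suc J) ℕₚ.≤-refl
    factor false = λ _ _ → refl
    absorb : (if not (vanishing (suc J)) then 1+q^ suc J else 𝟙) ⊛ cntSeries (suc J) ≈[ suc J ] cntSeries (suc J)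
    absorb = ≈[]-trans (suc J) (⊛-cong[] (suc J) (factor (not (vanishing (suc J)))) (λ _ _ → refl))
      (≈⇒≈[] (suc J) (⊛-identityˡ (cntSeries (suc J))))

  parity-Cbar : ∀ J → parity ∘ Cbar k i ≈[ suc J ] cntSeries J
  parity-Cbar J n (s≤s n≤J) = subst (λ J → parity (Cbar k i n) ≡ cntSeries J n) (ℕₚ.m∸n+n≡m n≤J) (go (J ∸ n))
    where
    go : ∀ d → parity (Cbar k i n) ≡ cntSeries (d + n) n
    go zero    = refl
    go (suc d) = trans (go d) (sym (cntSeries-stable (d + n) n (s≤s (ℕₚ.m≤n+m n d))))

  -- The series is inverse to the product over the sizes that do not vanish, so the full product (q;
  -- q) leaves the one over the vanishing sizes.
  Cbar-⊛-product : ∀ J →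
    (parity ∘ Cbar k i) ⊛ restrictedProduct (λ _ → true) J ≈[ suc J ] restrictedProduct vanishing J
  Cbar-⊛-product J = ≈[]-trans (suc J)
    (⊛-cong[] (suc J) (parity-Cbar J) (λ _ _ → refl))
    (≈⇒≈[] (suc J) (begin
      C ⊛ restrictedProduct (λ _ → true) J
        ≈⟨ ⊛-congˡ C (restrictedProduct-complement vanishing J) ⟨
      C ⊛ (V ⊛ V′)
        ≈⟨ solve 3 (λ c v v′ → c :* (v :* v′) := v :* (v′ :* c)) (λ _ → refl) C V V′ ⟩
      V ⊛ (V′ ⊛ C)
        ≈⟨ ⊛-congˡ V (restrictedProduct-⊛-cntSeries J) ⟩
      V ⊛ 𝟙
        ≈⟨ ⊛-identityʳ V ⟩
      V ∎))
    where
    C V V′ : Series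
    C  = cntSeries J
    V  = restrictedProduct vanishing J
    V′ = restrictedProduct (not ∘ vanishing) J

-- Products over residue classes as theta series

n≡ᵇn : ∀ n → (n ≡ᵇ n) ≡ true
n≡ᵇn zero    = refl
n≡ᵇn (suc n) = n≡ᵇn n

m<n⇒m≢ᵇn : ∀ {m n} → m < n → (m ≡ᵇ n) ≡ false
m<n⇒m≢ᵇn {zero}  (s≤s _)   = refl
m<n⇒m≢ᵇn {suc m} (s≤s m<n) = m<n⇒m≢ᵇn m<n

module _ (r : ℕ) where

  private
    k : ℕ
    k = 3 + r
    S : ℕ → Bool
    S = vanishing k 1

    residue : ℕ → Bool
    residue c = (c ≡ᵇ 0) ∨ ((c ≡ᵇ 1) ∨ (c ≡ᵇ 2 + r))

  vanishing-residue : ∀ j → S j ≡ residue (j % k)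
  vanishing-residue j rewrite m<n⇒m%n≡m (ℕₚ.n<1+n (2 + r)) = refl

  vanishing-block : ∀ c n → c < k → S (c + n * k) ≡ residue c
  vanishing-block c n c<k = trans (vanishing-residue (c + n * k))
    (cong residue (trans ([m+kn]%n≡m%n c n k) (m<n⇒m%n≡m c<k)))

  -- The residues 2, ..., k - 2 lie outside S, so their factors are 1.
  restrictedProduct-skip : ∀ n i → i ≤ r → restrictedProduct S (suc i + n * k) ≈ restrictedProduct S (1 + n * k)
  restrictedProduct-skip n zero    i≤r = ≈-refl
  restrictedProduct-skip n (suc i) i<r
    rewrite vanishing-block (2 + i) n (s≤s (s≤s (ℕₚ.m<n⇒m<1+n i<r))) | m<n⇒m≢ᵇn i<r =
    ≈-trans (⊛-identityʳ (restrictedProduct S (suc i + n * k))) (restrictedProduct-skip n i (ℕₚ.<⇒≤ i<r))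

  restrictedProduct-block : ∀ n →
    restrictedProduct S (suc n * k) ≈ restrictedProduct S (n * k) ⊛ 1+q^ (1 + n * k) ⊛ 1+q^ (2 + r + n * k) ⊛ 1+q^ (3 + r + n * k)
  restrictedProduct-block n
    rewrite trans (vanishing-residue (suc n * k)) (cong residue (m*n%n≡0 (suc n) k))
          | vanishing-block (2 + r) n ℕₚ.≤-refl | n≡ᵇn r = ⊛-congʳ (1+q^ (3 + r + n * k)) (⊛-congʳ (1+q^ (2 + r + n * k))
    (≈-trans (restrictedProduct-skip n r ℕₚ.≤-refl) first))
    where
    first : restrictedProduct S (1 + n * k) ≈ restrictedProduct S (n * k) ⊛ 1+q^ (1 + n * k)
    first rewrite vanishing-block 1 n (s≤s (s≤s z≤n)) = ≈-refl

  -- Each block of k consecutive sizes contributes one factor for each of the residues 0, 1 and k -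
  -- 1. The result is the product side of the triple product with a = 1 and b = k - 1.
  restrictedProduct-progression : ∀ n →
    restrictedProduct S (n * k) ≈ progression k k n ⊛ (progression k 1 n ⊛ progression k (2 + r) n)
  restrictedProduct-progression zero    = solve 0 (con 1ℙ := con 1ℙ :* (con 1ℙ :* con 1ℙ)) (λ _ → refl)
  restrictedProduct-progression (suc n) = begin
    restrictedProduct S (suc n * k)
      ≈⟨ restrictedProduct-block n ⟩
    restrictedProduct S (n * k) ⊛ x ⊛ y ⊛ z
      ≈⟨ ⊛-congʳ z (⊛-congʳ y (⊛-congʳ x (restrictedProduct-progression n))) ⟩
    P ⊛ (Q ⊛ R) ⊛ x ⊛ y ⊛ z
      ≈⟨ solve 6 (λ P Q R x y z → P :* (Q :* R) :* x :* y :* z := P :* z :* (Q :* x :* (R :* y))) (λ _ → refl) P Q R x y z ⟩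
    P ⊛ z ⊛ (Q ⊛ x ⊛ (R ⊛ y)) ∎
    where
    P Q R x y z : Series
    P = progression k k n
    Q = progression k 1 n
    R = progression k (2 + r) n
    x = 1+q^ (1 + n * k)
    y = 1+q^ (2 + r + n * k)
    z = 1+q^ (3 + r + n * k)

  module Theta = TripleProduct 1 (2 + r) (s≤s z≤n) (s≤s z≤n)
  open Theta public using (theta)

  restrictedProduct-theta : ∀ n → restrictedProduct S (n * k) ≈[ suc n ] theta n
  restrictedProduct-theta n =
    ≈[]-trans (suc n) (≈⇒≈[] (suc n) (restrictedProduct-progression n)) (Theta.triple-product n)

-- Every residue modulo 3 is 0 or ±1, so the full product (q; q) is the case k = 3, and its theta
-- series is that of the pentagonal number theorem.
vanishing-three : ∀ j → vanishing 3 1 j ≡ true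
vanishing-three j with j % 3 | m%n<n j 3
... | 0 | _ = refl
... | 1 | _ = refl
... | 2 | _ = refl
... | suc (suc (suc _)) | s≤s (s≤s (s≤s ()))

Cbar-⊛-theta : ∀ r n →
  (parity ∘ Cbar (3 + r) 1) ⊛ theta 0 (n * (3 + r)) ≈[ suc n ] theta r (n * 3)
Cbar-⊛-theta r n i i<1+n = coefficient
  where
  k J : ℕ
  k = 3 + r
  -- This bound is both nk blocks of length 3 and 3n blocks of length k, so both products end with a
  -- full block.
  J = n * k * 3
  C : Series
  C = parity ∘ Cbar k 1
  n≤n*k : n ≤ n * k
  n≤n*k = ℕₚ.m≤m*n n k
  i<J : i < suc J
  i<J = ℕₚ.<-≤-trans i<1+n (s≤s (ℕₚ.≤-trans n≤n*k (ℕₚ.m≤m*n (n * k) 3)))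
  swap : ∀ n k → n * k * 3 ≡ n * 3 * k
  swap = solve-∀
  coefficient : (C ⊛ theta 0 (n * k)) i ≡ theta r (n * 3) i
  coefficient = trans
    (⊛-cong[] (suc (n * k)) {f = C} (λ _ _ → refl)
      (λ m m<N → trans (sym (restrictedProduct-theta 0 (n * k) m m<N)) (restrictedProduct-cong J vanishing-three m))
      i (ℕₚ.<-≤-trans i<1+n (s≤s n≤n*k)))
    (trans (Cbar-⊛-product k 1 J i i<J)
      (trans (cong (λ J → restrictedProduct (vanishing k 1) J i) (swap n k))
        (restrictedProduct-theta r (n * 3) i (ℕₚ.<-≤-trans i<1+n (s≤s (ℕₚ.m≤m*n n 3))))))

-- The quadratic equation modulo 3

infix 4 _≡₃_
_≡₃_ : ℕ → ℕ → Set
m ≡₃ n = m % 3 ≡ n % 3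

+-cong₃ : ∀ a b c d → a ≡₃ b → c ≡₃ d → a + c ≡₃ b + d
+-cong₃ a b c d p q =
  trans (%-distribˡ-+ a c 3) (trans (cong₂ (λ x y → (x + y) % 3) p q) (sym (%-distribˡ-+ b d 3)))

*-cong₃ : ∀ a b c d → a ≡₃ b → c ≡₃ d → a * c ≡₃ b * d
*-cong₃ a b c d p q =
  trans (%-distribˡ-* a c 3) (trans (cong₂ (λ x y → (x * y) % 3) p q) (sym (%-distribˡ-* b d 3)))

%3-≡₃ : ∀ n → n ≡₃ n % 3
%3-≡₃ n = sym (m%n%n≡m%n n 3)

prime-≢₃0 : ∀ {p} → 5 ≤ p → Prime p → p % 3 ≢ 0
prime-≢₃0 {p} 5≤p prime-p p%3≡0 with prime⇒irreducible prime-p (m%n≡0⇒n∣m p 3 p%3≡0)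
... | inj₂ refl = contradiction 5≤p λ { (s≤s (s≤s (s≤s ()))) }

module _ (ℓ s : ℕ) (ℓ≡₃1 : ℓ % 3 ≡ 1) (p≢₃0 : (2 + s) % 3 ≢ 0) where

  private
    ℓ[3ℓ+1]≡₃1 : ℓ * (3 * ℓ + 1) ≡₃ 1
    ℓ[3ℓ+1]≡₃1 = *-cong₃ ℓ 1 (3 * ℓ + 1) 4 ℓ≡₃1
      (+-cong₃ (3 * ℓ) 3 1 1 (*-cong₃ 3 3 ℓ 1 refl ℓ≡₃1) refl)

    pm²-cong₃ : ∀ m → (2 + s) * (m * m) ≡₃ (2 + s % 3) * (m % 3 * (m % 3))
    pm²-cong₃ m = *-cong₃ (2 + s) (2 + s % 3) (m * m) (m % 3 * (m % 3)) (+-cong₃ 2 2 s (s % 3) refl (%3-≡₃ s))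
      (*-cong₃ m (m % 3) m (m % 3) (%3-≡₃ m) (%3-≡₃ m))

    ms-cong₃ : ∀ m → m * s ≡₃ m % 3 * (s % 3)
    ms-cong₃ m = *-cong₃ m (m % 3) s (s % 3) (%3-≡₃ m) (%3-≡₃ s)

    2+s%3≢0 : (2 + s % 3) % 3 ≢ 0
    2+s%3≢0 = p≢₃0 ∘ trans (+-cong₃ 2 2 s (s % 3) refl (%3-≡₃ s))

  -- Here p = 2 + s, so s is p - 2. The left side is 1 modulo 3, while pm² + ms is 2m² for p ≡ 2 and
  -- m(m + 2) for p ≡ 1, which never give 1.
  not-represented⁺ : ∀ m → ℓ * (3 * ℓ + 1) ≢ (2 + s) * (m * m) + m * s
  not-represented⁺ m eq = residues (s % 3) (m % 3) (m%n<n s 3) (m%n<n m 3) 2+s%3≢0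
    (trans (sym ℓ[3ℓ+1]≡₃1) (trans (cong (_% 3) eq)
      (+-cong₃ ((2 + s) * (m * m)) ((2 + s % 3) * (m % 3 * (m % 3))) (m * s) (m % 3 * (s % 3)) (pm²-cong₃ m) (ms-cong₃ m))))
    where
    residues : ∀ u v → u < 3 → v < 3 → (2 + u) % 3 ≢ 0 → 1 ≢ ((2 + u) * (v * v) + v * u) % 3
    residues 0 0 _ _ _ ()
    residues 0 1 _ _ _ ()
    residues 0 2 _ _ _ ()
    residues 1 _ _ _ p≢0 _ = p≢0 refl
    residues 2 0 _ _ _ ()
    residues 2 1 _ _ _ ()
    residues 2 2 _ _ _ ()
    residues (suc (suc (suc _))) _ (s≤s (s≤s (s≤s ())))
    residues _ (suc (suc (suc _))) _ (s≤s (s≤s (s≤s ())))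

  -- The subtracted term is moved to the left to stay in ℕ. Modulo 3, pm² - ms is 2m² or m(m + 1),
  -- again never 1.
  not-represented⁻ : ∀ m → ℓ * (3 * ℓ + 1) + m * s ≢ (2 + s) * (m * m)
  not-represented⁻ m eq = residues (s % 3) (m % 3) (m%n<n s 3) (m%n<n m 3) 2+s%3≢0
    (trans (sym (+-cong₃ (ℓ * (3 * ℓ + 1)) 1 (m * s) (m % 3 * (s % 3)) ℓ[3ℓ+1]≡₃1 (ms-cong₃ m)))
      (trans (cong (_% 3) eq) (pm²-cong₃ m)))
    where
    residues : ∀ u v → u < 3 → v < 3 → (2 + u) % 3 ≢ 0 → (1 + v * u) % 3 ≢ ((2 + u) * (v * v)) % 3
    residues 0 0 _ _ _ ()
    residues 0 1 _ _ _ ()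
    residues 0 2 _ _ _ ()
    residues 1 _ _ _ p≢0 _ = p≢0 refl
    residues 2 0 _ _ _ ()
    residues 2 1 _ _ _ ()
    residues 2 2 _ _ _ ()
    residues (suc (suc (suc _))) _ (s≤s (s≤s (s≤s ())))
    residues _ (suc (suc (suc _))) _ (s≤s (s≤s (s≤s ())))

-- The quadratic equation in integers and in theta exponents

pos-ℓ[3ℓ+1] : ∀ ℓ → + (ℓ * (3 * ℓ + 1)) ≡ + ℓ *ℤ (+ 3 *ℤ + ℓ +ℤ + 1)
pos-ℓ[3ℓ+1] ℓ = trans (ℤₚ.pos-* ℓ (3 * ℓ + 1)) (cong (λ x → + ℓ *ℤ (x +ℤ + 1)) (ℤₚ.pos-* 3 ℓ))

pos-pm² : ∀ p m → + (p * (m * m)) ≡ + p *ℤ (+ m *ℤ + m)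
pos-pm² p m = trans (ℤₚ.pos-* p (m * m)) (cong (+ p *ℤ_) (ℤₚ.pos-* m m))

i-j≡k⇒i≡k+j : ∀ {i j k} → i -ℤ j ≡ k → i ≡ k +ℤ j
i-j≡k⇒i≡k+j {i} {j} refl = sym (trans (ℤₚ.+-assoc i (negℤ j) j)
  (trans (cong (i +ℤ_) (ℤₚ.+-inverseˡ j)) (ℤₚ.+-identityʳ i)))

-- The closed form 2cr + Kr(r - 1) of the doubled exponent, with Kr moved across to avoid
-- subtraction.
double-exponent : ∀ K c r → 2 * exponent K c r + K * r ≡ 2 * (c * r) + K * (r * r)
double-exponent K c zero    = lemma K c
  where
  lemma : ∀ K c → 0 + K * 0 ≡ 2 * (c * 0) + K * 0
  lemma = solve-∀
double-exponent K c (suc r) =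
  trans (left K c r (exponent K c r)) (trans (cong (_+ (2 * (c + r * K) + K)) (double-exponent K c r)) (right K c r))
  where
  left : ∀ K c r e → 2 * (e + (c + r * K)) + K * suc r ≡ 2 * e + K * r + (2 * (c + r * K) + K)
  left = solve-∀
  right : ∀ K c r → 2 * (c * r) + K * (r * r) + (2 * (c + r * K) + K) ≡ 2 * (c * suc r) + K * (suc r * suc r)
  right = solve-∀

double-pentagonal : ∀ ℓ → 2 * exponent 3 2 ℓ ≡ ℓ * (3 * ℓ + 1)
double-pentagonal ℓ = ℕₚ.+-cancelʳ-≡ (3 * ℓ) (2 * exponent 3 2 ℓ) (ℓ * (3 * ℓ + 1))
  (trans (double-exponent 3 2 ℓ) (lemma ℓ))
  where
  lemma : ∀ ℓ → 2 * (2 * ℓ) + 3 * (ℓ * ℓ) ≡ ℓ * (3 * ℓ + 1) + 3 * ℓ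
  lemma = solve-∀

-- Doubled, the exponent with c = 1 is pm² - m(p - 2), where p = 2 + s; adding 2m to both sides
-- keeps the comparison in ℕ.
exponent-1≢pentagonal : ∀ ℓ s m → ℓ % 3 ≡ 1 → (2 + s) % 3 ≢ 0 → exponent (2 + s) 1 m ≢ exponent 3 2 ℓ
exponent-1≢pentagonal ℓ s m ℓ≡₃1 p≢₃0 eq = not-represented⁻ ℓ s ℓ≡₃1 p≢₃0 m
  (ℕₚ.+-cancelʳ-≡ (2 * m) _ _ (trans (left (ℓ * (3 * ℓ + 1)) s m)
    (trans (cong (_+ (2 + s) * m) (trans (sym (double-pentagonal ℓ)) (cong (2 *_) (sym eq))))
      (trans (double-exponent (2 + s) 1 m) (right s m)))))
  where
  left : ∀ x s m → x + m * s + 2 * m ≡ x + (2 + s) * m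
  left = solve-∀
  right : ∀ s m → 2 * (1 * m) + (2 + s) * (m * m) ≡ (2 + s) * (m * m) + 2 * m
  right = solve-∀

-- Doubled, the exponent with c = p - 1 is pm² + m(p - 2).
exponent-p-1≢pentagonal : ∀ ℓ s m → ℓ % 3 ≡ 1 → (2 + s) % 3 ≢ 0 → exponent (2 + s) (1 + s) m ≢ exponent 3 2 ℓ
exponent-p-1≢pentagonal ℓ s m ℓ≡₃1 p≢₃0 eq = not-represented⁺ ℓ s ℓ≡₃1 p≢₃0 m
  (ℕₚ.+-cancelʳ-≡ ((2 + s) * m) _ _
    (trans (cong (_+ (2 + s) * m) (trans (sym (double-pentagonal ℓ)) (cong (2 *_) (sym eq))))
      (trans (double-exponent (2 + s) (1 + s) m) (right s m))))
  where
  right : ∀ s m → 2 * ((1 + s) * m) + (2 + s) * (m * m) ≡ (2 + s) * (m * m) + m * s + (2 + s) * m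
  right = solve-∀

-- The coefficient at a pentagonal number

exponent-mono : ∀ K c {r r′} → r ≤ r′ → exponent K c r ≤ exponent K c r′
exponent-mono K c {r} r≤r′ = subst (λ r′ → exponent K c r ≤ exponent K c r′) (ℕₚ.m∸n+n≡m r≤r′) (go (_ ∸ r))
  where
  go : ∀ d → exponent K c r ≤ exponent K c (d + r)
  go zero    = ℕₚ.≤-refl
  go (suc d) = ℕₚ.≤-trans (go d) (ℕₚ.m≤m+n _ _)

-- At r = ℓ the gap is the remainder that ℓ(3ℓ - 1)/2 leaves in t; it is at least N because N ≤ ℓ.
pentagonal-gap : ∀ r → exponent 3 2 r ≡ exponent 3 1 r + r
pentagonal-gap zero    = refl
pentagonal-gap (suc r) = trans (cong (_+ (2 + r * 3)) (pentagonal-gap r)) (lemma (exponent 3 1 r) r)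
  where
  lemma : ∀ e r → e + r + (2 + r * 3) ≡ e + (1 + r * 3) + suc r
  lemma = solve-∀

pentagonal-≤ : ∀ r → exponent 3 1 r ≤ exponent 3 2 r
pentagonal-≤ r = ℕₚ.≤-trans (ℕₚ.m≤m+n _ r) (ℕₚ.≤-reflexive (sym (pentagonal-gap r)))

pentagonal-< : ∀ r → exponent 3 2 r < exponent 3 1 (suc r)
pentagonal-< r = subst (_< exponent 3 1 (suc r)) (sym (pentagonal-gap r))
  (ℕₚ.+-monoʳ-< (exponent 3 1 r) (s≤s (ℕₚ.m≤m*n r 3)))

theta-miss : ∀ r n t → (∀ m → exponent (3 + r) 1 m ≢ t) → (∀ m → exponent (3 + r) (2 + r) m ≢ t) → theta r n t ≡ 0ℙ
theta-miss r zero    t p p′ = q^-miss 0 t (p 0)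
theta-miss r (suc n) t p p′ = cong₂ ℙ._+_ (theta-miss r n t p p′)
  (cong₂ ℙ._+_ (q^-miss _ t (p (suc n))) (q^-miss _ t (p′ (suc n))))

module _ (C : Series) (N ℓ : ℕ) (N≤ℓ : N ≤ ℓ) (C₀ : C 0 ≡ 1ℙ)
         (odd : ∀ n → N ≤ n → n ≤ exponent 3 2 ℓ → C n ≡ 1ℙ) where

  private
    t : ℕ
    t = exponent 3 2 ℓ

    coefficient-≤ : ∀ e → e + N ≤ t → (C ⊛ q^ e) t ≡ 1ℙ
    coefficient-≤ e e+N≤t = trans (⊛-comm C (q^ e) t)
      (trans (cong (q^ e ⊛ C) (sym (ℕₚ.m+[n∸m]≡n e≤t)))
        (trans (q^-⊛-+ e C (t ∸ e))
          (odd (t ∸ e) (ℕₚ.m+n≤o⇒m≤o∸n N (subst (_≤ t) (ℕₚ.+-comm e N) e+N≤t)) (ℕₚ.m∸n≤m t e))))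
      where
      e≤t : e ≤ t
      e≤t = ℕₚ.≤-trans (ℕₚ.m≤m+n e N) e+N≤t

    coefficient-t : (C ⊛ q^ t) t ≡ 1ℙ
    coefficient-t = trans (⊛-comm C (q^ t) t)
      (trans (cong (q^ t ⊛ C) (sym (ℕₚ.+-identityʳ t))) (trans (q^-⊛-+ t C 0) C₀))

    coefficient-> : ∀ e → t < e → (C ⊛ q^ e) t ≡ 0ℙ
    coefficient-> e t<e = trans (⊛-comm C (q^ e) t) (q^-⊛-< e C t t<e)

    below : ∀ e → e ≤ exponent 3 1 ℓ → e + N ≤ t
    below e e≤ = ℕₚ.≤-trans (ℕₚ.+-mono-≤ e≤ N≤ℓ) (ℕₚ.≤-reflexive (sym (pentagonal-gap ℓ)))

    -- For r < ℓ both exponents leave a remainder in [N, t], so both coefficients are 1. For r = ℓ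
    -- the second leaves 0, where `C₀` gives 1. For r > ℓ both exponents exceed t.
    coefficient-pair : ∀ r → (C ⊛ q^ exponent 3 1 r) t ≡ (C ⊛ q^ exponent 3 2 r) t
    coefficient-pair r with ℕₚ.<-cmp r ℓ
    ... | tri< r<ℓ _ _ = trans (coefficient-≤ _ (below _ (exponent-mono 3 1 (ℕₚ.<⇒≤ r<ℓ))))
      (sym (coefficient-≤ _ (below _ (ℕₚ.≤-trans (ℕₚ.<⇒≤ (pentagonal-< r)) (exponent-mono 3 1 r<ℓ)))))
    ... | tri≈ _ refl _ = trans (coefficient-≤ _ (below _ ℕₚ.≤-refl)) (sym coefficient-t)
    ... | tri> _ _ ℓ<r = trans (coefficient-> _ t<e) (sym (coefficient-> _ (ℕₚ.<-≤-trans t<e (pentagonal-≤ r))))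
      where
      t<e : t < exponent 3 1 r
      t<e = ℕₚ.<-≤-trans (pentagonal-< ℓ) (exponent-mono 3 1 ℓ<r)

  -- The generalized pentagonal numbers up to t = ℓ(3ℓ+1)/2 are 0 and ℓ pairs, so an odd number of odd coefficients is added.
  ⊛-theta-odd : ∀ n → (C ⊛ theta 0 n) t ≡ 1ℙ
  ⊛-theta-odd zero    = trans (⊛-identityʳ C t) (odd t (ℕₚ.≤-trans N≤ℓ (r≤exponent 3 2 ℓ (s≤s z≤n))) ℕₚ.≤-refl)
  ⊛-theta-odd (suc n) = trans (⊛-distribˡ C (theta 0 n) (x ⊕ y) t)
    (cong₂ ℙ._+_ (⊛-theta-odd n)
      (trans (⊛-distribˡ C x y t)
        (trans (cong (ℙ._+ (C ⊛ y) t) (coefficient-pair (suc n))) (ℙₚ.p+p≡0ℙ ((C ⊛ y) t)))))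
    where
    x y : Series
    x = q^ exponent 3 1 (suc n)
    y = q^ exponent 3 2 (suc n)

-- Even values beyond every bound

parity≡0⇒2∣ : ∀ n → parity n ≡ 0ℙ → 2 ∣ n
parity≡0⇒2∣ zero          _ = divides-refl 0
parity≡0⇒2∣ (suc (suc n)) p = ∣m∣n⇒∣m+n (∣-refl {2}) (parity≡0⇒2∣ n p)

≢0ℙ⇒≡1ℙ : ∀ {x} → x ≢ 0ℙ → x ≡ 1ℙ
≢0ℙ⇒≡1ℙ {0ℙ} x≢0 = contradiction refl x≢0
≢0ℙ⇒≡1ℙ {1ℙ} _   = refl

-- A bounded search up to t either finds an even value or shows all values on [N, t] to be odd; then
-- the coefficient at t would be 1 by `⊛-theta-odd` and 0 by `theta-miss`.
infinitely-many-even : ∀ r → (3 + r) % 3 ≢ 0 → ∀ N → ∃[ n ] (N ≤ n × 2 ∣ Cbar (3 + r) 1 n)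
infinitely-many-even r p≢₃0 N
  with ℕₚ.anyUpTo? (λ n → (N ℕₚ.≤? n) ×-dec (parity (Cbar (3 + r) 1 n) ℙₚ.≟ 0ℙ)) (suc (exponent 3 2 (1 + suc N * 3)))
... | yes (n , _ , N≤n , even) = n , N≤n , parity≡0⇒2∣ (Cbar (3 + r) 1 n) even
... | no none = contradiction
  (trans (sym (⊛-theta-odd (parity ∘ Cbar (3 + r) 1) N ℓ N≤ℓ refl odd (t * (3 + r))))
    (trans (Cbar-⊛-theta r t t ℕₚ.≤-refl)
      (theta-miss r (t * 3) t (λ m → exponent-1≢pentagonal ℓ (suc r) m ℓ≡₃1 p≢₃0)
                              (λ m → exponent-p-1≢pentagonal ℓ (suc r) m ℓ≡₃1 p≢₃0))))
  λ ()
  where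
  ℓ t : ℕ
  -- Chosen to be 1 modulo 3 and at least N, independently of the ℓ in the theorem.
  ℓ = 1 + suc N * 3
  t = exponent 3 2 ℓ
  ℓ≡₃1 : ℓ % 3 ≡ 1
  ℓ≡₃1 = [m+kn]%n≡m%n 1 (suc N) 3
  N≤ℓ : N ≤ ℓ
  N≤ℓ = ℕₚ.≤-trans (ℕₚ.n≤1+n N) (ℕₚ.≤-trans (ℕₚ.m≤m*n (suc N) 3) (ℕₚ.n≤1+n _))
  odd : ∀ n → N ≤ n → n ≤ t → parity (Cbar (3 + r) 1 n) ≡ 1ℙ
  odd n N≤n n≤t = ≢0ℙ⇒≡1ℙ (λ even → none (n , s≤s n≤t , N≤n , even))

theorem1p1 : (ℓ p : ℕ) → 2 ≤ ℓ → ℓ % 3 ≡ 1 → 5 ≤ p → Prime p →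
    ((m : ℕ) → 1 ≤ m →
    (+ ℓ *ℤ (+ 3 *ℤ + ℓ +ℤ + 1) ≢ + p *ℤ (+ m *ℤ + m) +ℤ + m *ℤ (+ p -ℤ + 2))
    × (+ ℓ *ℤ (+ 3 *ℤ + ℓ +ℤ + 1) ≢ + p *ℤ (+ m *ℤ + m) -ℤ + m *ℤ (+ p -ℤ + 2)))
    × ((N : ℕ) → ∃[ n ] (N ≤ n × 2 ∣ Cbar p 1 n))
theorem1p1 ℓ p@(suc (suc (suc r))) _ ℓ≡₃1 5≤p prime-p =
  (λ m _ → not⁺ m , not⁻ m) , infinitely-many-even r p≢₃0
  where
  p≢₃0 : p % 3 ≢ 0
  p≢₃0 = prime-≢₃0 5≤p prime-p
  not⁺ : ∀ m → + ℓ *ℤ (+ 3 *ℤ + ℓ +ℤ + 1) ≢ + p *ℤ (+ m *ℤ + m) +ℤ + m *ℤ (+ p -ℤ + 2)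
  -- Since p = 3 + r, the integer p - 2 computes to `+ suc r`.
  not⁺ m eq = not-represented⁺ ℓ (suc r) ℓ≡₃1 p≢₃0 m (ℤₚ.+-injective
    (trans (pos-ℓ[3ℓ+1] ℓ) (trans eq (sym (cong₂ _+ℤ_ (pos-pm² p m) (ℤₚ.pos-* m (suc r)))))))
  not⁻ : ∀ m → + ℓ *ℤ (+ 3 *ℤ + ℓ +ℤ + 1) ≢ + p *ℤ (+ m *ℤ + m) -ℤ + m *ℤ (+ p -ℤ + 2)
  not⁻ m eq = not-represented⁻ ℓ (suc r) ℓ≡₃1 p≢₃0 m (ℤₚ.+-injective
    (trans (cong₂ _+ℤ_ (pos-ℓ[3ℓ+1] ℓ) (ℤₚ.pos-* m (suc r)))
      (trans (sym (i-j≡k⇒i≡k+j (sym eq))) (sym (pos-pm² p m)))))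
theorem1p1 ℓ 1 _ _ (s≤s ())
theorem1p1 ℓ 2 _ _ (s≤s (s≤s ()))
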